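{- Let $M=(E,\mathcal I)$ be a matroid on a finite ground set $E$, let $w:E\to\mathbb R$ be a weight function, let $E_0\subset E$ contain a basis of $M$, and let $T=|E\setminus E_0|$. Then the greedy algorithm described in the context finds an optimal solution of the problem IMD-MWB for $(M,w,E_0)$. That is, for any output $(e'_1,\ldots,e'_k)$ of the algorithm, the sets $A_0=\emptyset$, $A_i=\{e'_1,\ldots,e'_i\}$ for $1\leqslant i\leqslant k$, and $A_i=A_{i-1}+e'$ with an arbitrary $e'\in E\setminus(E_0\cup A_{i-1})$ for $k+1\leqslant i\leqslant T$, form an optimal solution of $$\min\left\{\sum_{i=0}^T f(A_i)\ :\ A_0=\emptyset,\ |A_i\setminus A_{i-1}|=1\text{ for }i=1,\ldots,T\right\}.$$
   Context: For a set $A$ and an element $e$ write $A+e=A\cup\{e\}$ and $A-e=A\setminus\{e\}$. The weight function is extended to subsets by $w(X)=\sum_{e\in X}w(e)$. For $A\subseteq E\setminus E_0$ let $$f(A)=\min\{w(X)\ :\ X\subseteq E_0\cup A\text{ is a basis of }M\}.$$ The incremental matroid design problem with minimum weight bases (IMD-MWB) with time horizon $T=|E\setminus E_0|$ is the displayed minimization problem in the claim, where the $A_i$ are subsets of $E\setminus E_0$. For a basis $X$ of $M$, a pair $(e,e')\in X\times(E\setminus X)$ is an exchange pair for $X$ if $X-e+e'$ is a basis; it is an optimal exchange pair for $X$ if $w(e)-w(e')$ is maximum among all exchange pairs for $X$. Greedy algorithm: Set $k\leftarrow 0$, let $w^*$ be the minimum weight of a basis of $M$, and let $X$ be any minimum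 weight basis of the submatroid induced by $E_0$ (which is also a basis of $M$). While $w(X)>w^*$: set $k\leftarrow k+1$; choose an optimal exchange pair $(e,e')$ for $X$; set $X\leftarrow X-e+e'$; set $e'_k\leftarrow e'$. Return $(e'_1,\ldots,e'_k)$. -}

module Defs where

open import Algebra.Bundles using (CommutativeMonoid)
open import Algebra.Properties.CommutativeSemigroup using (interchange)
open import Data.Bool using (if_then_else_)
open import Data.Fin using (Fin; zero; suc; toℕ; inject₁)
open import Data.Fin.Subset
  using (Subset; inside; outside; ⊥; ⊤; ⁅_⁆; ∁; ⋃; _∪_; _─_; _-_; _∈_; _∉_; _⊆_; ∣_∣)
open import Data.Fin.Subset.Properties
  using (_∈?_; _⊆?_; ⊥⊆; ⊆⊤; ⊆-trans; x∈p∪q⁻; x∈⁅y⁆⇒x≡y; p⊆p∪q; anySubset?)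
open import Data.List using (List; []; _∷_; _++_; map; filter; foldr; length; take)
open import Data.Nat as ℕ using (ℕ; zero; suc)
import Data.Nat.Properties as ℕ
open import Data.Product using (∃; ∃-syntax; _×_; _,_; proj₁; proj₂)
open import Data.Rational as ℚ using (ℚ; 0ℚ; ½)
import Data.Rational.Properties as ℚ
open import Data.Sum using (inj₁; inj₂)
import Data.Vec as Vec
import Data.Vec.Functional as Vector
open import Function using (_∘_)
open import Relation.Binary.PropositionalEquality
  using (_≡_; sym; trans; cong; subst)
open import Relation.Nullary
  using (¬_; does; ¬?; _×-dec_; map′; decidable-stable)
open import Relation.Unary using (Decidable)

------------------------------------------------------------------------
-- Real numbers

-- Quantifying over both m and n makes the one-sided bound equivalent
-- to ∣ x m - x n ∣ ≤ ε.
Cauchy : (ℕ → ℚ) → Set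
Cauchy x = ∀ ε → 0ℚ ℚ.< ε →
  ∃[ N ] (∀ m n → N ℕ.≤ m → N ℕ.≤ n → x m ℚ.≤ x n ℚ.+ ε)

-- The equality of reals is the setoid equality x ≤ᴿ y × y ≤ᴿ x.
record ℝ : Set where
  constructor mkℝ
  field
    seq    : ℕ → ℚ
    cauchy : Cauchy seq

open ℝ public

infix  4 _≤ᴿ_ _<ᴿ_
infixl 6 _+ᴿ_ _-ᴿ_
infixl 7 _⊓ᴿ_

record _≤ᴿ_ (x y : ℝ) : Set where
  constructor mk≤
  field
    bound : ∀ ε → 0ℚ ℚ.< ε →
            ∃[ N ] (∀ n → N ℕ.≤ n → seq x n ℚ.≤ seq y n ℚ.+ ε)

record _<ᴿ_ (x y : ℝ) : Set where
  constructor mk<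
  field
    gap : ∃[ ε ] 0ℚ ℚ.< ε × ∃[ N ] (∀ n → N ℕ.≤ n → seq x n ℚ.+ ε ℚ.≤ seq y n)

-- Abstract for performance only: without it the checker unfolds these
-- proofs whenever it normalises a real-valued expression.
abstract
  ½ε>0 : ∀ {ε} → 0ℚ ℚ.< ε → 0ℚ ℚ.< ½ ℚ.* ε
  ½ε>0 {ε} ε>0 = subst (ℚ._< ½ ℚ.* ε) (ℚ.*-zeroʳ ½) (ℚ.*-monoʳ-<-pos ½ ε>0)

  ½ε+½ε≡ε : ∀ ε → ½ ℚ.* ε ℚ.+ ½ ℚ.* ε ≡ ε
  ½ε+½ε≡ε ε = trans (sym (ℚ.*-distribʳ-+ ε ½ ½)) (ℚ.*-identityˡ ε)

  ℚ-interchange : ∀ a b c d → (a ℚ.+ b) ℚ.+ (c ℚ.+ d) ≡ (a ℚ.+ c) ℚ.+ (b ℚ.+ d)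
  ℚ-interchange = interchange
    (CommutativeMonoid.commutativeSemigroup ℚ.+-0-commutativeMonoid)

  +-cauchy : ∀ {x y} → Cauchy x → Cauchy y → Cauchy (λ n → x n ℚ.+ y n)
  +-cauchy {x} {y} cx cy ε ε>0
    with cx (½ ℚ.* ε) (½ε>0 ε>0) | cy (½ ℚ.* ε) (½ε>0 ε>0)
  ... | M , hx | N , hy = M ℕ.⊔ N , λ m n p q →
    subst (x m ℚ.+ y m ℚ.≤_)
      (trans (ℚ-interchange (x n) _ (y n) _)
             (cong (x n ℚ.+ y n ℚ.+_) (½ε+½ε≡ε ε)))
      (ℚ.+-mono-≤ (hx m n (ℕ.m⊔n≤o⇒m≤o M N p) (ℕ.m⊔n≤o⇒m≤o M N q))
                  (hy m n (ℕ.m⊔n≤o⇒n≤o M N p) (ℕ.m⊔n≤o⇒n≤o M N q)))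

  neg-flip : ∀ a b ε → a ℚ.≤ b ℚ.+ ε → ℚ.- b ℚ.≤ ℚ.- a ℚ.+ ε
  neg-flip a b ε h =
    subst (ℚ._≤ ℚ.- a ℚ.+ ε)
      (trans (cong (ℚ._+ ε) (ℚ.neg-distrib-+ b ε))
        (trans (ℚ.+-assoc (ℚ.- b) (ℚ.- ε) ε)
          (trans (cong (ℚ.- b ℚ.+_) (ℚ.+-inverseˡ ε)) (ℚ.+-identityʳ (ℚ.- b)))))
      (ℚ.+-monoˡ-≤ ε (ℚ.neg-antimono-≤ h))

  neg-cauchy : ∀ {x} → Cauchy x → Cauchy (λ n → ℚ.- x n)
  neg-cauchy {x} cx ε ε>0 with cx ε ε>0
  ... | N , h = N , λ m n p q → neg-flip (x n) (x m) ε (h n m q p)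

  ⊓-cauchy : ∀ {x y} → Cauchy x → Cauchy y → Cauchy (λ n → x n ℚ.⊓ y n)
  ⊓-cauchy {x} {y} cx cy ε ε>0 with cx ε ε>0 | cy ε ε>0
  ... | M , hx | N , hy = M ℕ.⊔ N , λ m n p q →
    subst (x m ℚ.⊓ y m ℚ.≤_)
      (sym (ℚ.mono-≤-distrib-⊓ (ℚ.+-monoˡ-≤ ε) (x n) (y n)))
      (ℚ.⊓-mono-≤ (hx m n (ℕ.m⊔n≤o⇒m≤o M N p) (ℕ.m⊔n≤o⇒m≤o M N q))
                  (hy m n (ℕ.m⊔n≤o⇒n≤o M N p) (ℕ.m⊔n≤o⇒n≤o M N q)))

  const-cauchy : ∀ q → Cauchy (λ _ → q)
  const-cauchy q ε ε>0 = 0 , λ _ _ _ _ →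
    subst (ℚ._≤ q ℚ.+ ε) (ℚ.+-identityʳ q) (ℚ.+-monoʳ-≤ q (ℚ.<⇒≤ ε>0))

0ᴿ : ℝ
0ᴿ = mkℝ (λ _ → 0ℚ) (const-cauchy 0ℚ)

_+ᴿ_ : ℝ → ℝ → ℝ
x +ᴿ y = mkℝ (λ n → seq x n ℚ.+ seq y n) (+-cauchy (cauchy x) (cauchy y))

-ᴿ_ : ℝ → ℝ
-ᴿ x = mkℝ (λ n → ℚ.- seq x n) (neg-cauchy (cauchy x))

_-ᴿ_ : ℝ → ℝ → ℝ
x -ᴿ y = x +ᴿ (-ᴿ y)

_⊓ᴿ_ : ℝ → ℝ → ℝ
x ⊓ᴿ y = mkℝ (λ n → seq x n ℚ.⊓ seq y n) (⊓-cauchy (cauchy x) (cauchy y))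

sumᴿ : ∀ {n} → (Fin n → ℝ) → ℝ
sumᴿ = Vector.foldr _+ᴿ_ 0ᴿ

------------------------------------------------------------------------
-- Matroids

infixl 5 _+ₑ_

_+ₑ_ : ∀ {n} → Subset n → Fin n → Subset n
A +ₑ e = A ∪ ⁅ e ⁆

-- The ground set is Fin n.  Decidability of independence is automatic
-- classically: it says that the independent sets form a subset of the
-- finite power set.
record Matroid (n : ℕ) : Set₁ where
  field
    Independent  : Subset n → Set
    independent? : Decidable Independent
    ⊥-indep      : Independent ⊥
    hereditary   : ∀ {I J} → I ⊆ J → Independent J → Independent I
    augmentation : ∀ {I J} → Independent I → Independent J → ∣ I ∣ ℕ.< ∣ J ∣ →
                   ∃[ e ] e ∈ J × e ∉ I × Independent (I +ₑ e)

open Matroid public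

IsBasis : ∀ {n} → Matroid n → Subset n → Set
IsBasis M X =
  Independent M X × (∀ Y → Independent M Y → X ⊆ Y → Y ⊆ X)

isBasis? : ∀ {n} (M : Matroid n) → Decidable (IsBasis M)
isBasis? {n} M X = independent? M X ×-dec map′ to from
  (¬? (anySubset? λ Y → independent? M Y ×-dec (X ⊆? Y) ×-dec ¬? (Y ⊆? X)))
  where
  Larger : Set
  Larger = ∃[ Y ] Independent M Y × X ⊆ Y × ¬ (Y ⊆ X)

  Maximal : Set
  Maximal = ∀ Y → Independent M Y → X ⊆ Y → Y ⊆ X

  to : ¬ Larger → Maximal
  to none Y iY X⊆Y = decidable-stable (Y ⊆? X) λ Y⊈X → none (Y , iY , X⊆Y , Y⊈X)

  from : Maximal → ¬ Larger
  from max (Y , iY , X⊆Y , Y⊈X) = Y⊈X (max Y iY X⊆Y)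

-- The submatroid induced by S.  Its ground set is still written as
-- Fin n, with the elements outside S turned into loops; the independent
-- sets, and hence the bases, are those of the induced submatroid.
_∣ᴹ_ : ∀ {n} → Matroid n → Subset n → Matroid n
M ∣ᴹ S = record
  { Independent  = λ I → Independent M I × I ⊆ S
  ; independent? = λ I → independent? M I ×-dec (I ⊆? S)
  ; ⊥-indep      = ⊥-indep M , ⊥⊆
  ; hereditary   = λ I⊆J (iJ , J⊆S) → hereditary M I⊆J iJ , ⊆-trans I⊆J J⊆S
  ; augmentation = augment
  }
  where
  augment : ∀ {I J} → Independent M I × I ⊆ S → Independent M J × J ⊆ S →
            ∣ I ∣ ℕ.< ∣ J ∣ →
            ∃[ e ] e ∈ J × e ∉ I × Independent M (I +ₑ e) × I +ₑ e ⊆ S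
  augment {I} {J} (iI , I⊆S) (iJ , J⊆S) I<J
    with augmentation M iI iJ I<J
  ... | e , e∈J , e∉I , iI+e = e , e∈J , e∉I , iI+e , I+e⊆S
    where
    I+e⊆S : I +ₑ e ⊆ S
    I+e⊆S x∈ with x∈p∪q⁻ I ⁅ e ⁆ x∈
    ... | inj₁ x∈I = I⊆S x∈I
    ... | inj₂ x∈e = subst (_∈ S) (sym (x∈⁅y⁆⇒x≡y e x∈e)) (J⊆S e∈J)

------------------------------------------------------------------------
-- Weights

weight : ∀ {n} → (Fin n → ℝ) → Subset n → ℝ
weight w X = sumᴿ λ e → if does (e ∈? X) then w e else 0ᴿ

subsets : ∀ n → List (Subset n)
subsets zero    = Vec.[] ∷ []
subsets (suc n) =
  map (inside Vec.∷_) (subsets n) ++ map (outside Vec.∷_) (subsets n)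

BasisWithin : ∀ {n} → Matroid n → Subset n → Set
BasisWithin M S = ∃[ X ] IsBasis M X × X ⊆ S

-- The minimum of w(X) over the bases X ⊆ S of M.  The given basis X₀ ⊆ S
-- only shows that the minimum is over a nonempty family; it is itself a
-- member of that family, so starting the fold at w(X₀) is harmless.
minWeight : ∀ {n} (M : Matroid n) (w : Fin n → ℝ) (S : Subset n) →
            BasisWithin M S → ℝ
minWeight {n} M w S (X₀ , _) =
  foldr (λ X v → weight w X ⊓ᴿ v) (weight w X₀)
    (filter (λ X → isBasis? M X ×-dec (X ⊆? S)) (subsets n))

IsMinWeightBasis : ∀ {n} → Matroid n → (Fin n → ℝ) → Subset n → Set
IsMinWeightBasis M w X =
  IsBasis M X × (∀ Y → IsBasis M Y → weight w X ≤ᴿ weight w Y)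

------------------------------------------------------------------------
-- Exchange pairs

ExchangePair : ∀ {n} → Matroid n → Subset n → Fin n → Fin n → Set
ExchangePair M X e e′ = e ∈ X × e′ ∉ X × IsBasis M (X - e +ₑ e′)

OptimalExchangePair : ∀ {n} → Matroid n → (Fin n → ℝ) → Subset n →
                      Fin n → Fin n → Set
OptimalExchangePair M w X e e′ =
  ExchangePair M X e e′ ×
  (∀ d d′ → ExchangePair M X d d′ → w d -ᴿ w d′ ≤ᴿ w e -ᴿ w e′)

------------------------------------------------------------------------
-- The problem IMD-MWB and the greedy algorithm

module IMD {n} (M : Matroid n) (w : Fin n → ℝ) (E₀ : Subset n)
           (basis₀ : BasisWithin M E₀) where

  T : ℕ
  T = ∣ ∁ E₀ ∣

  f : Subset n → ℝ
  f A = minWeight M w (E₀ ∪ A)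
    (proj₁ basis₀ , proj₁ (proj₂ basis₀) ,
     ⊆-trans (proj₂ (proj₂ basis₀)) (p⊆p∪q A))

  w* : ℝ
  w* = minWeight M w ⊤ (proj₁ basis₀ , proj₁ (proj₂ basis₀) , ⊆⊤)

  Sequence : Set
  Sequence = Fin (suc T) → Subset n

  record Feasible (A : Sequence) : Set where
    field
      outside-E₀ : ∀ i → A i ⊆ ∁ E₀
      initial    : A zero ≡ ⊥
      increment  : ∀ (i : Fin T) → ∣ A (suc i) ─ A (inject₁ i) ∣ ≡ 1

  objective : Sequence → ℝ
  objective A = sumᴿ (f ∘ A)

  Optimal : Sequence → Set
  Optimal A = Feasible A × (∀ B → Feasible B → objective A ≤ᴿ objective B)

  -- Loop X es: started with current basis X, the while loop can terminate
  -- having recorded exactly the entering elements es, in order.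
  data Loop (X : Subset n) : List (Fin n) → Set where
    stop : ¬ (w* <ᴿ weight w X) → Loop X []
    step : ∀ {e e′ es} → w* <ᴿ weight w X → OptimalExchangePair M w X e e′ →
           Loop (X - e +ₑ e′) es → Loop X (e′ ∷ es)

  GreedyOutput : List (Fin n) → Set
  GreedyOutput es = ∃[ X ] IsMinWeightBasis (M ∣ᴹ E₀) w X × Loop X es

  record Completes (es : List (Fin n)) (A : Sequence) : Set where
    field
      prefix : ∀ i → toℕ i ℕ.≤ length es → A i ≡ ⋃ (map ⁅_⁆ (take (toℕ i) es))
      beyond : ∀ (i : Fin T) → length es ℕ.≤ toℕ i →
               ∃[ e′ ] e′ ∉ E₀ ∪ A (inject₁ i) × A (suc i) ≡ A (inject₁ i) +ₑ e′

{-# OPTIONS --safe #-}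

-- Charge a penalty μ ≥ 0 for every element outside E₀.  A basis X minimising
-- the penalised weight has minimum weight among all bases with at most
-- ∣ X ─ E₀ ∣ elements outside E₀.  The greedy algorithm maintains a
-- minimiser for some μ: an improving exchange must replace an element of E₀
-- by one outside E₀, and by optimality its gain δ satisfies δ ≤ μ.  For the
-- penalty δ the basis is still locally, hence globally, optimal, while the
-- exchange costs nothing, so the next basis minimises the weight with
-- penalty δ.  Thus after i steps exactly i elements lie outside E₀, and f is
-- minimised at every index separately.
--
-- No case distinction on the order of reals is needed, as x ≤ᴿ y follows
-- from ¬ (y <ᴿ x).

module Submission where

open import Algebra.Bundles using (AbelianGroup)
import Algebra.Definitions.RawMonoid as RawMonoid
import Algebra.Properties.CommutativeSemigroup as CommutativeSemigroup
open import Algebra.Properties.Group using (//-rightDividesˡ; //-rightDividesʳ)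
open import Data.Bool using (if_then_else_)
open import Data.Empty using (⊥-elim)
open import Data.Fin using (Fin; zero; suc; _≟_; toℕ; inject₁)
open import Data.Fin.Induction using (<-weakInduction)
open import Data.Fin.Properties using (any?; toℕ-inject₁)
open import Data.Fin.Subset
open import Data.Fin.Subset.Induction using (⊂-wellFounded)
open import Data.Fin.Subset.Properties
open import Data.List using (List; []; _∷_; map; foldr; take; length)
import Data.List.Membership.Propositional as List
open import Data.List.Membership.Propositional.Properties
  using (∈-filter⁺; ∈-map⁺; ∈-++⁺ˡ; ∈-++⁺ʳ)
open import Data.List.Relation.Unary.All as All using (All; []; _∷_)
open import Data.List.Relation.Unary.All.Properties using (all-filter)
open import Data.List.Relation.Unary.Any using (here; there)
open import Data.Nat as ℕ using (ℕ; zero; suc; _≤_)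
import Data.Nat.Properties as ℕ
open import Data.Product using (∃-syntax; _×_; _,_; proj₁; proj₂)
open import Data.Rational as ℚ using (ℚ; 0ℚ; ½)
import Data.Rational.Properties as ℚ
open import Data.Rational.Solver using (module +-*-Solver)
open import Data.Sum using (_⊎_; inj₁; inj₂; [_,_]′)
open import Data.Vec as Vec using ([]; _∷_)
open import Data.Vec.Properties using (lookup∘tabulate; lookup⇒[]=; []=⇒lookup)
open import Defs
open import Function using (_∘_; id)
open import Induction.WellFounded using (Acc; acc)
open import Relation.Binary using (Preorder)
open import Relation.Binary.PropositionalEquality
  using (_≡_; refl; sym; trans; cong; cong₂; subst; subst₂)
open import Relation.Nullary
  using (¬_; yes; no; does; ¬?; _×-dec_; decidable-stable)
open import Relation.Nullary.Decidable using (dec-true; dec-false)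
open import Relation.Unary using (Decidable)

private variable n : ℕ

-- Real numbers

infix 4 _≐_

-- Finer than equality of reals, but all the algebraic identities needed
-- hold already at this level.
record _≐_ (x y : ℝ) : Set where
  constructor mk≐
  field
    termwise : ∀ m → seq x m ≡ seq y m

open _≐_

+-abelianGroup : AbelianGroup _ _
+-abelianGroup = record
  { Carrier = ℝ
  ; _≈_ = _≐_
  ; _∙_ = _+ᴿ_
  ; ε = 0ᴿ
  ; _⁻¹ = -ᴿ_
  ; isAbelianGroup = record
    { isGroup = record
      { isMonoid = record
        { isSemigroup = record
          { isMagma = record
            { isEquivalence = record
              { refl = mk≐ λ _ → refl
              ; sym = λ p → mk≐ λ m → sym (termwise p m)
              ; trans = λ p q → mk≐ λ m → trans (termwise p m) (termwise q m)
              }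
            ; ∙-cong = λ p q → mk≐ λ m → cong₂ ℚ._+_ (termwise p m) (termwise q m)
            }
          ; assoc = λ x y z → mk≐ λ m → ℚ.+-assoc (seq x m) (seq y m) (seq z m)
          }
        ; identity = (λ x → mk≐ λ m → ℚ.+-identityˡ (seq x m))
                   , (λ x → mk≐ λ m → ℚ.+-identityʳ (seq x m))
        }
      ; inverse = (λ x → mk≐ λ m → ℚ.+-inverseˡ (seq x m))
                , (λ x → mk≐ λ m → ℚ.+-inverseʳ (seq x m))
      ; ⁻¹-cong = λ p → mk≐ λ m → cong ℚ.-_ (termwise p m)
      }
    ; comm = λ x y → mk≐ λ m → ℚ.+-comm (seq x m) (seq y m)
    }
  }

open AbelianGroup +-abelianGroup using ()
  renaming (refl to ≐-refl; sym to ≐-sym; trans to ≐-trans)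

x≤y⇒x≤y+ε : ∀ {x y ε} → 0ℚ ℚ.< ε → x ℚ.≤ y → x ℚ.≤ y ℚ.+ ε
x≤y⇒x≤y+ε {x} {y} {ε} ε>0 x≤y =
  subst (ℚ._≤ y ℚ.+ ε) (ℚ.+-identityʳ x) (ℚ.+-mono-≤ x≤y (ℚ.<⇒≤ ε>0))

≤ᴿ-reflexive : ∀ {x y} → x ≐ y → x ≤ᴿ y
≤ᴿ-reflexive x≐y = mk≤ λ ε ε>0 → 0 , λ n _ →
  x≤y⇒x≤y+ε ε>0 (ℚ.≤-reflexive (termwise x≐y n))

≤ᴿ-trans : ∀ {x y z} → x ≤ᴿ y → y ≤ᴿ z → x ≤ᴿ z
≤ᴿ-trans {x} {y} {z} (mk≤ p) (mk≤ q) = mk≤ λ ε ε>0 →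
  let M , x≤y = p (½ ℚ.* ε) (½ε>0 ε>0)
      N , y≤z = q (½ ℚ.* ε) (½ε>0 ε>0)
  in M ℕ.⊔ N , λ n M⊔N≤n → begin
    seq x n                                ≤⟨ x≤y n (ℕ.m⊔n≤o⇒m≤o M N M⊔N≤n) ⟩
    seq y n ℚ.+ ½ ℚ.* ε                    ≤⟨ ℚ.+-monoˡ-≤ _ (y≤z n (ℕ.m⊔n≤o⇒n≤o M N M⊔N≤n)) ⟩
    (seq z n ℚ.+ ½ ℚ.* ε) ℚ.+ ½ ℚ.* ε      ≡⟨ ℚ.+-assoc (seq z n) _ _ ⟩
    seq z n ℚ.+ (½ ℚ.* ε ℚ.+ ½ ℚ.* ε)      ≡⟨ cong (seq z n ℚ.+_) (½ε+½ε≡ε ε) ⟩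
    seq z n ℚ.+ ε                          ∎
  where open ℚ.≤-Reasoning

≤ᴿ-preorder : Preorder _ _ _
≤ᴿ-preorder = record
  { Carrier = ℝ
  ; _≈_ = _≐_
  ; _≲_ = _≤ᴿ_
  ; isPreorder = record
    { isEquivalence = AbelianGroup.isEquivalence +-abelianGroup
    ; reflexive = ≤ᴿ-reflexive
    ; trans = ≤ᴿ-trans
    }
  }

≤ᴿ-refl : ∀ {x} → x ≤ᴿ x
≤ᴿ-refl = ≤ᴿ-reflexive ≐-refl

+-mono-≤ᴿ : ∀ {x y u v} → x ≤ᴿ y → u ≤ᴿ v → x +ᴿ u ≤ᴿ y +ᴿ v
+-mono-≤ᴿ {x} {y} {u} {v} (mk≤ p) (mk≤ q) = mk≤ λ ε ε>0 →
  let M , x≤y = p (½ ℚ.* ε) (½ε>0 ε>0)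
      N , u≤v = q (½ ℚ.* ε) (½ε>0 ε>0)
  in M ℕ.⊔ N , λ n M⊔N≤n → begin
    seq x n ℚ.+ seq u n
      ≤⟨ ℚ.+-mono-≤ (x≤y n (ℕ.m⊔n≤o⇒m≤o M N M⊔N≤n)) (u≤v n (ℕ.m⊔n≤o⇒n≤o M N M⊔N≤n)) ⟩
    (seq y n ℚ.+ ½ ℚ.* ε) ℚ.+ (seq v n ℚ.+ ½ ℚ.* ε)
      ≡⟨ ℚ-interchange (seq y n) _ (seq v n) _ ⟩
    (seq y n ℚ.+ seq v n) ℚ.+ (½ ℚ.* ε ℚ.+ ½ ℚ.* ε)
      ≡⟨ cong (seq y n ℚ.+ seq v n ℚ.+_) (½ε+½ε≡ε ε) ⟩
    (seq y n ℚ.+ seq v n) ℚ.+ ε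
      ∎
  where open ℚ.≤-Reasoning

+-monoˡ-≤ᴿ : ∀ z {x y} → x ≤ᴿ y → x +ᴿ z ≤ᴿ y +ᴿ z
+-monoˡ-≤ᴿ z x≤y = +-mono-≤ᴿ x≤y ≤ᴿ-refl

+-monoʳ-≤ᴿ : ∀ z {x y} → x ≤ᴿ y → z +ᴿ x ≤ᴿ z +ᴿ y
+-monoʳ-≤ᴿ z = +-mono-≤ᴿ ≤ᴿ-refl

⊓-lowerˡ : ∀ x y → x ⊓ᴿ y ≤ᴿ x
⊓-lowerˡ x y = mk≤ λ ε ε>0 → 0 , λ n _ → x≤y⇒x≤y+ε ε>0 (ℚ.p⊓q≤p (seq x n) (seq y n))

⊓-lowerʳ : ∀ x y → x ⊓ᴿ y ≤ᴿ y
⊓-lowerʳ x y = mk≤ λ ε ε>0 → 0 , λ n _ → x≤y⇒x≤y+ε ε>0 (ℚ.p⊓q≤q (seq x n) (seq y n))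

⊓-greatest : ∀ {x y z} → z ≤ᴿ x → z ≤ᴿ y → z ≤ᴿ x ⊓ᴿ y
⊓-greatest {x} {y} {z} (mk≤ p) (mk≤ q) = mk≤ λ ε ε>0 →
  let M , z≤x = p ε ε>0
      N , z≤y = q ε ε>0
  in M ℕ.⊔ N , λ n M⊔N≤n →
    subst (seq z n ℚ.≤_) (sym (ℚ.mono-≤-distrib-⊓ (ℚ.+-monoˡ-≤ ε) (seq x n) (seq y n)))
      (ℚ.⊓-glb (z≤x n (ℕ.m⊔n≤o⇒m≤o M N M⊔N≤n)) (z≤y n (ℕ.m⊔n≤o⇒n≤o M N M⊔N≤n)))

-- Applying `y ≤ᴿ x` with half of the gap ε as tolerance would give ε ≤ ½ε at a late index.
<ᴿ⇒≱ᴿ : ∀ {x y} → x <ᴿ y → ¬ (y ≤ᴿ x)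
<ᴿ⇒≱ᴿ {x} {y} (mk< (ε , ε>0 , M , x+ε≤y)) (mk≤ p) =
  let η = ½ ℚ.* ε
      N , y≤x = p η (½ε>0 ε>0)
      n = M ℕ.⊔ N
      x+ε≤x+η = ℚ.≤-trans (x+ε≤y n (ℕ.m≤m⊔n M N)) (y≤x n (ℕ.m≤n⊔m M N))
      η<ε = subst (η ℚ.<_) (½ε+½ε≡ε ε)
              (subst (ℚ._< η ℚ.+ η) (ℚ.+-identityʳ η) (ℚ.+-monoʳ-< η (½ε>0 ε>0)))
  in ℚ.<-irrefl refl (ℚ.<-≤-trans (ℚ.+-monoʳ-< (seq x n) η<ε) x+ε≤x+η)

<ᴿ⇒≤ᴿ : ∀ {x y} → x <ᴿ y → x ≤ᴿ y
<ᴿ⇒≤ᴿ {x} {y} (mk< (ε , ε>0 , N , x+ε≤y)) = mk≤ λ ε′ ε′>0 → N , λ n N≤n →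
  x≤y⇒x≤y+ε ε′>0 (ℚ.≤-trans (x≤y⇒x≤y+ε ε>0 ℚ.≤-refl) (x+ε≤y n N≤n))

+-cancelʳ-≤ : ∀ r p q → p ℚ.+ r ℚ.≤ q ℚ.+ r → p ℚ.≤ q
+-cancelʳ-≤ r p q p+r≤q+r = subst₂ ℚ._≤_ (cancel p) (cancel q) (ℚ.+-monoˡ-≤ (ℚ.- r) p+r≤q+r)
  where
  cancel = //-rightDividesʳ ℚ.+-0-group r

-- Comparing the two sequences at one late index N decides between y ≤ x + ε
-- and x < y; the margins η and κ absorb the oscillation beyond N.
≮ᴿ⇒≥ᴿ : ∀ {x y} → ¬ (x <ᴿ y) → y ≤ᴿ x
≮ᴿ⇒≥ᴿ {x} {y} x≮y = mk≤ close
  where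
  open ℚ.≤-Reasoning
  close : ∀ ε → 0ℚ ℚ.< ε → ∃[ N ] (∀ n → N ≤ n → seq y n ℚ.≤ seq x n ℚ.+ ε)
  close ε ε>0 = N , bound
    where
    -- The margins are ε/2, ε/4 and ε/8. Moving between `N` and a later index costs κ per sequence,
    -- so a lead of δ at `N` still leaves δ - 2κ = η beyond it.
    δ = ½ ℚ.* ε
    η = ½ ℚ.* δ
    κ = ½ ℚ.* η
    δ>0 = ½ε>0 ε>0
    η>0 = ½ε>0 δ>0
    κ>0 = ½ε>0 η>0
    Nx = proj₁ (cauchy x κ κ>0)
    Ny = proj₁ (cauchy y κ κ>0)
    N = Nx ℕ.⊔ Ny

    near-x : ∀ m n → N ≤ m → N ≤ n → seq x m ℚ.≤ seq x n ℚ.+ κ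
    near-x m n N≤m N≤n = proj₂ (cauchy x κ κ>0) m n
      (ℕ.m⊔n≤o⇒m≤o Nx Ny N≤m) (ℕ.m⊔n≤o⇒m≤o Nx Ny N≤n)

    near-y : ∀ m n → N ≤ m → N ≤ n → seq y m ℚ.≤ seq y n ℚ.+ κ
    near-y m n N≤m N≤n = proj₂ (cauchy y κ κ>0) m n
      (ℕ.m⊔n≤o⇒n≤o Nx Ny N≤m) (ℕ.m⊔n≤o⇒n≤o Nx Ny N≤n)

    κ+κ+η≡δ : κ ℚ.+ κ ℚ.+ η ≡ δ
    κ+κ+η≡δ = trans (cong (ℚ._+ η) (½ε+½ε≡ε η)) (½ε+½ε≡ε δ)

    regroup : ∀ a b c → a ℚ.+ b ℚ.+ c ℚ.+ b ≡ a ℚ.+ (b ℚ.+ b ℚ.+ c)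
    regroup = solve 3 (λ a b c → a :+ b :+ c :+ b := a :+ (b :+ b :+ c)) refl
      where open +-*-Solver

    x<y : seq x N ℚ.+ δ ℚ.≤ seq y N → x <ᴿ y
    x<y xN+δ≤yN = mk< (η , η>0 , N , λ n N≤n → +-cancelʳ-≤ κ _ _ (begin
      seq x n ℚ.+ η ℚ.+ κ          ≤⟨ ℚ.+-monoˡ-≤ κ (ℚ.+-monoˡ-≤ η (near-x n N N≤n ℕ.≤-refl)) ⟩
      seq x N ℚ.+ κ ℚ.+ η ℚ.+ κ    ≡⟨ regroup (seq x N) κ η ⟩
      seq x N ℚ.+ (κ ℚ.+ κ ℚ.+ η)  ≡⟨ cong (seq x N ℚ.+_) κ+κ+η≡δ ⟩
      seq x N ℚ.+ δ                ≤⟨ xN+δ≤yN ⟩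
      seq y N                      ≤⟨ near-y N n ℕ.≤-refl N≤n ⟩
      seq y n ℚ.+ κ                ∎))

    bound : ∀ n → N ≤ n → seq y n ℚ.≤ seq x n ℚ.+ ε
    bound n N≤n with ℚ.≤-total (seq x N ℚ.+ δ) (seq y N)
    ... | inj₁ xN+δ≤yN = ⊥-elim (x≮y (x<y xN+δ≤yN))
    ... | inj₂ yN≤xN+δ = begin
      seq y n                            ≤⟨ near-y n N N≤n ℕ.≤-refl ⟩
      seq y N ℚ.+ κ                      ≤⟨ ℚ.+-monoˡ-≤ κ yN≤xN+δ ⟩
      seq x N ℚ.+ δ ℚ.+ κ                ≤⟨ ℚ.+-monoˡ-≤ κ (ℚ.+-monoˡ-≤ δ (near-x N n ℕ.≤-refl N≤n)) ⟩
      seq x n ℚ.+ κ ℚ.+ δ ℚ.+ κ          ≡⟨ regroup (seq x n) κ δ ⟩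
      -- The spare η is added only to round κ + κ up to δ, which makes the total δ + δ = ε.
      seq x n ℚ.+ (κ ℚ.+ κ ℚ.+ δ)        ≤⟨ ℚ.+-monoʳ-≤ (seq x n)
                                              (ℚ.+-monoˡ-≤ δ (x≤y⇒x≤y+ε {y = κ ℚ.+ κ} η>0 ℚ.≤-refl)) ⟩
      seq x n ℚ.+ (κ ℚ.+ κ ℚ.+ η ℚ.+ δ)  ≡⟨ cong (λ z → seq x n ℚ.+ (z ℚ.+ δ)) κ+κ+η≡δ ⟩
      seq x n ℚ.+ (δ ℚ.+ δ)              ≡⟨ cong (seq x n ℚ.+_) (½ε+½ε≡ε ε) ⟩
      seq x n ℚ.+ ε                      ∎

open AbelianGroup +-abelianGroup using () renaming
  ( ∙-cong to +-cong; ∙-congˡ to +-congˡ; ∙-congʳ to +-congʳ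
  ; comm to +-comm; assoc to +-assoc
  ; identityˡ to +-identityˡ; identityʳ to +-identityʳ)

open RawMonoid (AbelianGroup.rawMonoid +-abelianGroup)
  using () renaming (_×_ to _·_)

open CommutativeSemigroup (AbelianGroup.commutativeSemigroup +-abelianGroup)
  using (interchange; xy∙z≈xz∙y)

open import Relation.Binary.Reasoning.Preorder ≤ᴿ-preorder

x-y+y≐x : ∀ y x → x -ᴿ y +ᴿ y ≐ x
x-y+y≐x = //-rightDividesˡ (AbelianGroup.group +-abelianGroup)

x+y-y≐x : ∀ y x → x +ᴿ y -ᴿ y ≐ x
x+y-y≐x = //-rightDividesʳ (AbelianGroup.group +-abelianGroup)

+-cancelʳ-≤ᴿ : ∀ z {x y} → x +ᴿ z ≤ᴿ y +ᴿ z → x ≤ᴿ y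
+-cancelʳ-≤ᴿ z {x} {y} x+z≤y+z = begin
  x            ≈⟨ x+y-y≐x z x ⟨
  x +ᴿ z -ᴿ z  ≲⟨ +-monoˡ-≤ᴿ (-ᴿ z) x+z≤y+z ⟩
  y +ᴿ z -ᴿ z  ≈⟨ x+y-y≐x z y ⟩
  y            ∎

+-cancelˡ-≤ᴿ : ∀ z {x y} → z +ᴿ x ≤ᴿ z +ᴿ y → x ≤ᴿ y
+-cancelˡ-≤ᴿ z {x} {y} z+x≤z+y = +-cancelʳ-≤ᴿ z (begin
  x +ᴿ z  ≈⟨ +-comm x z ⟩
  z +ᴿ x  ≲⟨ z+x≤z+y ⟩
  z +ᴿ y  ≈⟨ +-comm z y ⟩
  y +ᴿ z  ∎)

x-y≤z⇒x≤y+z : ∀ {x y z} → x -ᴿ y ≤ᴿ z → x ≤ᴿ y +ᴿ z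
x-y≤z⇒x≤y+z {x} {y} {z} x-y≤z = begin
  x            ≈⟨ x-y+y≐x y x ⟨
  x -ᴿ y +ᴿ y  ≲⟨ +-monoˡ-≤ᴿ y x-y≤z ⟩
  z +ᴿ y       ≈⟨ +-comm z y ⟩
  y +ᴿ z       ∎

x≤y+z⇒x-y≤z : ∀ {x y z} → x ≤ᴿ y +ᴿ z → x -ᴿ y ≤ᴿ z
x≤y+z⇒x-y≤z {x} {y} {z} x≤y+z = +-cancelʳ-≤ᴿ y (begin
  x -ᴿ y +ᴿ y  ≈⟨ x-y+y≐x y x ⟩
  x            ≲⟨ x≤y+z ⟩
  y +ᴿ z       ≈⟨ +-comm y z ⟩
  z +ᴿ y       ∎)

x-y≤0⇒x≤y : ∀ {x y} → x -ᴿ y ≤ᴿ 0ᴿ → x ≤ᴿ y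
x-y≤0⇒x≤y {x} {y} x-y≤0 = ≤ᴿ-trans (x-y≤z⇒x≤y+z x-y≤0) (≤ᴿ-reflexive (+-identityʳ y))

x≤y⇒x-y≤0 : ∀ {x y} → x ≤ᴿ y → x -ᴿ y ≤ᴿ 0ᴿ
x≤y⇒x-y≤0 {x} {y} x≤y = x≤y+z⇒x-y≤z (≤ᴿ-trans x≤y (≤ᴿ-reflexive (≐-sym (+-identityʳ y))))

0≤x⇒y≤y+x : ∀ {x} y → 0ᴿ ≤ᴿ x → y ≤ᴿ y +ᴿ x
0≤x⇒y≤y+x {x} y 0≤x = begin
  y        ≈⟨ +-identityʳ y ⟨
  y +ᴿ 0ᴿ  ≲⟨ +-monoʳ-≤ᴿ y 0≤x ⟩
  y +ᴿ x   ∎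

·-monoˡ-≤ᴿ : ∀ {x i j} → 0ᴿ ≤ᴿ x → i ≤ j → i · x ≤ᴿ j · x
·-monoˡ-≤ᴿ {j = zero} 0≤x ℕ.z≤n = ≤ᴿ-refl
·-monoˡ-≤ᴿ {x} {j = suc j} 0≤x ℕ.z≤n = begin
  0ᴿ            ≲⟨ ·-monoˡ-≤ᴿ {x} {j = j} 0≤x ℕ.z≤n ⟩
  j · x         ≈⟨ +-identityˡ _ ⟨
  0ᴿ +ᴿ j · x   ≲⟨ +-monoˡ-≤ᴿ (j · x) 0≤x ⟩
  x +ᴿ j · x    ∎
·-monoˡ-≤ᴿ {x} 0≤x (ℕ.s≤s i≤j) = +-monoʳ-≤ᴿ x (·-monoˡ-≤ᴿ 0≤x i≤j)

sumᴿ-mono-≤ᴿ : ∀ {g h : Fin n → ℝ} → (∀ i → g i ≤ᴿ h i) → sumᴿ g ≤ᴿ sumᴿ h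
sumᴿ-mono-≤ᴿ {zero}  g≤h = ≤ᴿ-refl
sumᴿ-mono-≤ᴿ {suc n} g≤h = +-mono-≤ᴿ (g≤h zero) (sumᴿ-mono-≤ᴿ (g≤h ∘ suc))

-- Subsets of a finite set

x∈p∪⁅y⁆⁻ : ∀ {p : Subset n} {x y} → x ∈ p +ₑ y → x ∈ p ⊎ x ≡ y
x∈p∪⁅y⁆⁻ {p = p} {y = y} x∈ with x∈p∪q⁻ p ⁅ y ⁆ x∈
... | inj₁ x∈p = inj₁ x∈p
... | inj₂ x∈y = inj₂ (x∈⁅y⁆⇒x≡y y x∈y)

p⊆p+x : ∀ {p : Subset n} {x} → p ⊆ p +ₑ x
p⊆p+x {x = x} = p⊆p∪q ⁅ x ⁆

x∈p+x : ∀ {p : Subset n} {x} → x ∈ p +ₑ x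
x∈p+x {p = p} {x} = q⊆p∪q p ⁅ x ⁆ (x∈⁅x⁆ x)

p+x⊆q : ∀ {p q : Subset n} {x} → p ⊆ q → x ∈ q → p +ₑ x ⊆ q
p+x⊆q {q = q} p⊆q x∈q y∈ with x∈p∪⁅y⁆⁻ y∈
... | inj₁ y∈p = p⊆q y∈p
... | inj₂ y≡x = subst (_∈ q) (sym y≡x) x∈q

x∈p─q⇒x∉q : ∀ (p : Subset n) {q x} → x ∈ p ─ q → x ∉ q
x∈p─q⇒x∉q (_ ∷ p) {outside ∷ q} {zero} x∈p─q ()
x∈p─q⇒x∉q (_ ∷ p) {inside ∷ q} {zero} ()
x∈p─q⇒x∉q (_ ∷ p) {_ ∷ q} {suc x} x∈p─q x∈q = x∈p─q⇒x∉q p (drop-there x∈p─q) (drop-there x∈q)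

x∈p-y⇒x∈p : ∀ (p : Subset n) {x} y → x ∈ p - y → x ∈ p
x∈p-y⇒x∈p p y = p─q⊆p p ⁅ y ⁆

x∉p-x : ∀ (p : Subset n) x → x ∉ p - x
x∉p-x p x x∈p-x = x∈p─q⇒x∉q p x∈p-x (x∈⁅x⁆ x)

p-x+x≡p : ∀ {p : Subset n} {x} → x ∈ p → p - x +ₑ x ≡ p
p-x+x≡p {p = p} {x} x∈p = ⊆-antisym
  (p+x⊆q (x∈p-y⇒x∈p p x) x∈p) p⊆
  where
  p⊆ : p ⊆ p - x +ₑ x
  p⊆ {y} y∈p with y ≟ x
  ... | yes refl = x∈p+x
  ... | no y≢x = p⊆p+x (x∈p∧x≢y⇒x∈p-y y∈p y≢x)

∣p+x∣≡1+∣p∣ : ∀ {p : Subset n} {x} → x ∉ p → ∣ p +ₑ x ∣ ≡ suc ∣ p ∣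
∣p+x∣≡1+∣p∣ {p = inside ∷ p} {zero} x∉p = ⊥-elim (x∉p Vec.here)
∣p+x∣≡1+∣p∣ {p = outside ∷ p} {zero} x∉p = cong (suc ∘ ∣_∣) (∪-identityʳ p)
∣p+x∣≡1+∣p∣ {p = inside ∷ p} {suc x} x∉p = cong suc (∣p+x∣≡1+∣p∣ (x∉p ∘ Vec.there))
∣p+x∣≡1+∣p∣ {p = outside ∷ p} {suc x} x∉p = ∣p+x∣≡1+∣p∣ (x∉p ∘ Vec.there)

∣p∣≡1+∣p-x∣ : ∀ {p : Subset n} {x} → x ∈ p → ∣ p ∣ ≡ suc ∣ p - x ∣
∣p∣≡1+∣p-x∣ {p = p} {x} x∈p =
  trans (cong ∣_∣ (sym (p-x+x≡p x∈p))) (∣p+x∣≡1+∣p∣ (x∉p-x p x))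

∣p-x+y∣≡∣p∣ : ∀ {p : Subset n} {x y} → x ∈ p → y ∉ p → ∣ p - x +ₑ y ∣ ≡ ∣ p ∣
∣p-x+y∣≡∣p∣ {p = p} {x} x∈p y∉p =
  trans (∣p+x∣≡1+∣p∣ (y∉p ∘ x∈p-y⇒x∈p p x)) (sym (∣p∣≡1+∣p-x∣ x∈p))

p⊈q⇒∃ : ∀ (p q : Subset n) → ¬ (p ⊆ q) → ∃[ x ] x ∈ p × x ∉ q
p⊈q⇒∃ p q p⊈q with any? (λ x → (x ∈? p) ×-dec ¬? (x ∈? q))
... | yes found = found
... | no none = ⊥-elim (p⊈q λ {x} x∈p →
  decidable-stable (x ∈? q) λ x∉q → none (x , x∈p , x∉q))

p⊆q∧∣q∣≤∣p∣⇒q⊆p : ∀ {p q : Subset n} → p ⊆ q → ∣ q ∣ ≤ ∣ p ∣ → q ⊆ p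
p⊆q∧∣q∣≤∣p∣⇒q⊆p {p = p} {q} p⊆q q≤p = decidable-stable (q ⊆? p) λ q⊈p →
  ℕ.<⇒≱ (p⊂q⇒∣p∣<∣q∣ (p⊆q , p⊈q⇒∃ q p q⊈p)) q≤p

comprehension : {P : Fin n → Set} → Decidable P → Subset n
comprehension P? = Vec.tabulate (does ∘ P?)

∈-comprehension⁺ : ∀ {P : Fin n → Set} (P? : Decidable P) {x} → P x → x ∈ comprehension P?
∈-comprehension⁺ P? {x} Px =
  lookup⇒[]= x _ (trans (lookup∘tabulate (does ∘ P?) x) (dec-true (P? x) Px))

∈-comprehension⁻ : ∀ {P : Fin n → Set} (P? : Decidable P) {x} → x ∈ comprehension P? → P x
∈-comprehension⁻ P? {x} x∈ with P? x | trans (sym (lookup∘tabulate (does ∘ P?) x)) ([]=⇒lookup x∈)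
... | yes Px | _ = Px
... | no _ | ()

∣q─p∣+∣p∣≡∣q∪p∣ : ∀ (q p : Subset n) → ∣ q ─ p ∣ ℕ.+ ∣ p ∣ ≡ ∣ q ∪ p ∣
∣q─p∣+∣p∣≡∣q∪p∣ [] [] = refl
∣q─p∣+∣p∣≡∣q∪p∣ (inside ∷ q) (outside ∷ p) = cong suc (∣q─p∣+∣p∣≡∣q∪p∣ q p)
∣q─p∣+∣p∣≡∣q∪p∣ (outside ∷ q) (outside ∷ p) = ∣q─p∣+∣p∣≡∣q∪p∣ q p
∣q─p∣+∣p∣≡∣q∪p∣ (inside ∷ q) (inside ∷ p) =
  trans (ℕ.+-suc ∣ q ─ p ∣ ∣ p ∣) (cong suc (∣q─p∣+∣p∣≡∣q∪p∣ q p))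
∣q─p∣+∣p∣≡∣q∪p∣ (outside ∷ q) (inside ∷ p) =
  trans (ℕ.+-suc ∣ q ─ p ∣ ∣ p ∣) (cong suc (∣q─p∣+∣p∣≡∣q∪p∣ q p))

∣q∣≤∣q─p∣+∣p∣ : ∀ (q p : Subset n) → ∣ q ∣ ≤ ∣ q ─ p ∣ ℕ.+ ∣ p ∣
∣q∣≤∣q─p∣+∣p∣ q p =
  subst (∣ q ∣ ≤_) (sym (∣q─p∣+∣p∣≡∣q∪p∣ q p)) (∣p∣≤∣p∪q∣ q p)

p⊆q⇒q∪p≡q : ∀ {p q : Subset n} → p ⊆ q → q ∪ p ≡ q
p⊆q⇒q∪p≡q {p = p} {q} p⊆q = ⊆-antisym
  (λ x∈ → [ id , p⊆q ]′ (x∈p∪q⁻ q p x∈)) (p⊆p∪q p)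

p⊆q⇒p─q≡⊥ : ∀ {p q : Subset n} → p ⊆ q → p ─ q ≡ ⊥
p⊆q⇒p─q≡⊥ {p = p} {q} p⊆q = Empty-unique λ (x , x∈) → x∈p─q⇒x∉q p x∈ (p⊆q (p─q⊆p p q x∈))

p⊆q∪[p─q] : ∀ (p q : Subset n) → p ⊆ q ∪ (p ─ q)
p⊆q∪[p─q] p q {x} x∈p with x ∈? q
... | yes x∈q = p⊆p∪q (p ─ q) x∈q
... | no x∉q = q⊆p∪q q (p ─ q) (x∈p∧x∉q⇒x∈p─q x∈p x∉q)

p⊆q∪r⇒p─q⊆r : ∀ {p q r : Subset n} → p ⊆ q ∪ r → p ─ q ⊆ r
p⊆q∪r⇒p─q⊆r {p = p} {q} {r} p⊆ x∈ =
  [ ⊥-elim ∘ x∈p─q⇒x∉q p x∈ , id ]′ (x∈p∪q⁻ q r (p⊆ (p─q⊆p p q x∈)))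

p-x+y─q≡[p─q]+y : ∀ {p q : Subset n} {x y} → x ∈ q → y ∉ q → (p - x +ₑ y) ─ q ≡ (p ─ q) +ₑ y
p-x+y─q≡[p─q]+y {p = p} {q} {x} {y} x∈q y∉q = ⊆-antisym ⊆₁
  (p+x⊆q ⊆₂ (x∈p∧x∉q⇒x∈p─q x∈p+x y∉q))
  where
  ⊆₁ : (p - x +ₑ y) ─ q ⊆ (p ─ q) +ₑ y
  ⊆₁ z∈ with x∈p∪⁅y⁆⁻ (p─q⊆p (p - x +ₑ y) q z∈)
  ... | inj₁ z∈p-x = p⊆p+x (x∈p∧x∉q⇒x∈p─q (x∈p-y⇒x∈p p x z∈p-x) (x∈p─q⇒x∉q (p - x +ₑ y) z∈))
  ... | inj₂ refl = x∈p+x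

  ⊆₂ : p ─ q ⊆ (p - x +ₑ y) ─ q
  ⊆₂ z∈ = x∈p∧x∉q⇒x∈p─q
    (p⊆p+x (x∈p∧x≢y⇒x∈p-y (p─q⊆p p q z∈) λ { refl → z∉q x∈q })) z∉q
    where z∉q = x∈p─q⇒x∉q p z∈

⋃-take-⊆ : ∀ i (es : List (Fin n)) →
           ⋃ (map ⁅_⁆ (take i es)) ⊆ ⋃ (map ⁅_⁆ (take (suc i) es))
⋃-take-⊆ zero es = ⊥⊆
⋃-take-⊆ (suc i) [] = id
⋃-take-⊆ (suc i) (e ∷ es) x∈ =
  x∈p∪q⁺ ([ inj₁ , inj₂ ∘ ⋃-take-⊆ i es ]′ (x∈p∪q⁻ ⁅ e ⁆ (⋃ (map ⁅_⁆ (take i es))) x∈))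

-- Matroids

module _ (M : Matroid n) where

  -- If `I` were larger, augmentation would enlarge `B`, against its maximality.
  indep-≤-basis : ∀ {I B} → Independent M I → IsBasis M B → ∣ I ∣ ≤ ∣ B ∣
  indep-≤-basis {I} {B} iI (iB , maxB) = ℕ.≮⇒≥ λ B<I →
    let e , _ , e∉B , iB+e = augmentation M iB iI B<I
    in e∉B (maxB (B +ₑ e) iB+e p⊆p+x x∈p+x)

  large-indep⇒basis : ∀ {I B} → Independent M I → IsBasis M B → ∣ B ∣ ≤ ∣ I ∣ → IsBasis M I
  large-indep⇒basis iI basisB B≤I = iI , λ Y iY I⊆Y →
    p⊆q∧∣q∣≤∣p∣⇒q⊆p I⊆Y (ℕ.≤-trans (indep-≤-basis iY basisB) B≤I)

  exchange⇒basis : ∀ {B x y} → IsBasis M B → x ∈ B → y ∉ B →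
                   Independent M (B - x +ₑ y) → IsBasis M (B - x +ₑ y)
  exchange⇒basis basisB x∈B y∉B i =
    large-indep⇒basis i basisB (ℕ.≤-reflexive (sym (∣p-x+y∣≡∣p∣ x∈B y∉B)))

  -- Augmentation from `J` is repeated; the counter `d` in `go` is the number of elements still to
  -- be added.
  extend : ∀ {I J} → Independent M I → Independent M J → ∣ I ∣ ≤ ∣ J ∣ →
           ∃[ K ] Independent M K × I ⊆ K × K ⊆ I ∪ J × ∣ K ∣ ≡ ∣ J ∣
  extend {I} {J} iI iJ I≤J = go (∣ J ∣ ℕ.∸ ∣ I ∣) iI (ℕ.m∸n+n≡m I≤J) (p⊆p∪q J) id
    where
    go : ∀ d {L} → Independent M L → d ℕ.+ ∣ L ∣ ≡ ∣ J ∣ → L ⊆ I ∪ J → I ⊆ L →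
         ∃[ K ] Independent M K × I ⊆ K × K ⊆ I ∪ J × ∣ K ∣ ≡ ∣ J ∣
    go zero {L} iL L≡J L⊆ I⊆L = L , iL , I⊆L , L⊆ , L≡J
    go (suc d) {L} iL d+L≡J L⊆ I⊆L
      with augmentation M iL iJ (subst (∣ L ∣ ℕ.<_) d+L≡J (ℕ.s≤s (ℕ.m≤n+m ∣ L ∣ d)))
    ... | e , e∈J , e∉L , iL+e = go d iL+e
      (trans (cong (d ℕ.+_) (∣p+x∣≡1+∣p∣ e∉L)) (trans (ℕ.+-suc d ∣ L ∣) d+L≡J))
      (p+x⊆q L⊆ (q⊆p∪q I J e∈J)) (p⊆p+x ∘ I⊆L)

  -- D + e contains the fundamental circuit of e over Y; hence some element
  -- of D is not spanned by X - e.
  symmetric-exchange : ∀ {X Y e} → IsBasis M X → IsBasis M Y → e ∈ X → e ∉ Y →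
    ∃[ y ] y ∈ Y × y ∉ X × IsBasis M (X - e +ₑ y) × IsBasis M (Y - y +ₑ e)
  symmetric-exchange {X} {Y} {e} basisX basisY e∈X e∉Y = result
    where
    iX = proj₁ basisX
    iY = proj₁ basisY
    iX-e = hereditary M (x∈p-y⇒x∈p X e) iX

    inD? : Decidable λ y → y ∈ Y × Independent M (Y - y +ₑ e)
    inD? y = (y ∈? Y) ×-dec independent? M (Y - y +ₑ e)

    D = comprehension inD?

    D⊆Y : D ⊆ Y
    D⊆Y = proj₁ ∘ ∈-comprehension⁻ inD?

    iD = hereditary M D⊆Y iY

    -- An independent `D +ₑ e` would extend by elements of `Y` to some `K` of size `∣ Y ∣`. As `K`
    -- contains e, it misses some z in `Y`, so it equals `Y - z +ₑ e`. Then z belongs to `D`, hence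
    -- to `K`, a contradiction.
    D+e-dependent : ¬ Independent M (D +ₑ e)
    D+e-dependent iD+e with extend iD+e iY (indep-≤-basis iD+e basisY)
    ... | K , iK , D+e⊆K , K⊆ , K≡Y
      with p⊈q⇒∃ Y K (λ Y⊆K → e∉Y (proj₂ basisY K iK Y⊆K (D+e⊆K x∈p+x)))
    ... | z , z∈Y , z∉K = z∉K (D+e⊆K (p⊆p+x (∈-comprehension⁺ inD? (z∈Y , iY-z+e))))
      where
      K⊆Y-z+e : K ⊆ Y - z +ₑ e
      K⊆Y-z+e {k} k∈K = [ [ fromY ∘ D⊆Y , (λ { refl → x∈p+x }) ]′ ∘ x∈p∪⁅y⁆⁻ , fromY ]′
        (x∈p∪q⁻ (D +ₑ e) Y (K⊆ k∈K))
        where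
        fromY : k ∈ Y → k ∈ Y - z +ₑ e
        fromY k∈Y = p⊆p+x (x∈p∧x≢y⇒x∈p-y k∈Y λ { refl → z∉K k∈K })

      iY-z+e = hereditary M
        (p⊆q∧∣q∣≤∣p∣⇒q⊆p K⊆Y-z+e
          (ℕ.≤-reflexive (trans (∣p-x+y∣≡∣p∣ z∈Y e∉Y) (sym K≡Y))))
        iK

    Result = ∃[ y ] y ∈ Y × y ∉ X × IsBasis M (X - e +ₑ y) × IsBasis M (Y - y +ₑ e)

    fromD : ∀ {y} → y ∈ D → y ∉ X - e → Independent M (X - e +ₑ y) → Result
    fromD {y} y∈D y∉X-e iX-e+y with ∈-comprehension⁻ inD? y∈D
    ... | y∈Y , iY-y+e = y , y∈Y , y∉X , exchange⇒basis basisX e∈X y∉X iX-e+y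
                           , exchange⇒basis basisY y∈Y e∉Y iY-y+e
      where
      y∉X : y ∉ X
      y∉X y∈X = y∉X-e (x∈p∧x≢y⇒x∈p-y y∈X λ { refl → e∉Y y∈Y })

    X-e<X : ∣ X - e ∣ ℕ.< ∣ X ∣
    X-e<X = x∈p⇒∣p-x∣<∣p∣ e∈X

    result : Result
    -- It suffices to find y in `D` outside `X - e` that keeps `X - e` independent. Augmentation
    -- yields one directly if `D` is the larger set.
    result with ∣ D ∣ ℕ.≤? ∣ X - e ∣
    ... | no D≰X-e =
      let y , y∈D , y∉X-e , i = augmentation M iX-e iD (ℕ.≰⇒> D≰X-e)
      in fromD y∈D y∉X-e i
    -- Otherwise `D` is filled up from `X - e` to a set `K` of the same size as `X - e`, and `K` is
    -- augmented from `X` by x. The choice x = e would make `D +ₑ e` independent. So x lies in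
    -- `X - e`, and augmenting `X - e` from `K +ₑ x` can only bring in an element of `D`.
    ... | yes D≤X-e with extend iD iX-e D≤X-e
    ...   | K , iK , D⊆K , K⊆ , K≡X-e
        with augmentation M iK iX (subst (ℕ._< ∣ X ∣) (sym K≡X-e) X-e<X)
    ...     | x , x∈X , x∉K , iK+x with x ≟ e
    ...       | yes refl = ⊥-elim (D+e-dependent
                  (hereditary M (p+x⊆q (p⊆p+x ∘ D⊆K) x∈p+x) iK+x))
    ...       | no x≢e
        with augmentation M iX-e iK+x
               (ℕ.≤-reflexive (sym (trans (∣p+x∣≡1+∣p∣ x∉K) (cong suc K≡X-e))))
    ...         | y , y∈K+x , y∉X-e , i with x∈p∪⁅y⁆⁻ y∈K+x
    ...           | inj₂ refl = ⊥-elim (y∉X-e (x∈p∧x≢y⇒x∈p-y x∈X x≢e))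
    ...           | inj₁ y∈K with x∈p∪q⁻ D (X - e) (K⊆ y∈K)
    ...             | inj₁ y∈D = fromD y∈D y∉X-e i
    ...             | inj₂ y∈X-e = ⊥-elim (y∉X-e y∈X-e)

-- The basis of `M` inside `S` is independent in the restriction, so `X` is at least as large.
basis∣ᴹ⇒basis : ∀ (M : Matroid n) {S X} → BasisWithin M S → IsBasis (M ∣ᴹ S) X → IsBasis M X
basis∣ᴹ⇒basis M {S} (B , basisB , B⊆S) basisX@((iX , _) , _) =
  large-indep⇒basis M iX basisB (indep-≤-basis (M ∣ᴹ S) (proj₁ basisB , B⊆S) basisX)

basis⇒basis∣ᴹ : ∀ (M : Matroid n) {S X} → IsBasis M X → X ⊆ S → IsBasis (M ∣ᴹ S) X
basis⇒basis∣ᴹ M (iX , maxX) X⊆S = (iX , X⊆S) , λ Y (iY , _) → maxX Y iY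

exchange-⊆ : ∀ {X S : Subset n} {e e′} → X ⊆ S → e′ ∈ S → X - e +ₑ e′ ⊆ S
exchange-⊆ {X = X} {e = e} X⊆S = p+x⊆q (X⊆S ∘ x∈p-y⇒x∈p X e)

-- Weights

weight-insert : ∀ (w : Fin n → ℝ) {X e} → e ∉ X → weight w (X +ₑ e) ≐ weight w X +ᴿ w e
weight-insert w {inside ∷ X} {zero} e∉X = ⊥-elim (e∉X Vec.here)
weight-insert w {outside ∷ X} {zero} e∉X = begin-equality
  w zero +ᴿ weight (w ∘ suc) (X ∪ ⊥)        ≡⟨ cong (λ Y → w zero +ᴿ weight (w ∘ suc) Y) (∪-identityʳ X) ⟩
  w zero +ᴿ weight (w ∘ suc) X              ≈⟨ +-comm _ _ ⟩
  weight (w ∘ suc) X +ᴿ w zero              ≈⟨ +-congʳ (+-identityˡ _) ⟨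
  0ᴿ +ᴿ weight (w ∘ suc) X +ᴿ w zero        ∎
weight-insert w {inside ∷ X} {suc e} e∉X =
  ≐-trans (+-congˡ (weight-insert (w ∘ suc) (e∉X ∘ Vec.there))) (≐-sym (+-assoc _ _ _))
weight-insert w {outside ∷ X} {suc e} e∉X =
  ≐-trans (+-congˡ (weight-insert (w ∘ suc) (e∉X ∘ Vec.there))) (≐-sym (+-assoc _ _ _))

-- The removed weight stands on the left instead of being subtracted, so that comparisons reduce to
-- cancelling a common summand.
weight-exchange : ∀ (w : Fin n → ℝ) {X e e′} → e ∈ X → e′ ∉ X →
                  weight w (X - e +ₑ e′) +ᴿ w e ≐ weight w X +ᴿ w e′
weight-exchange w {X} {e} {e′} e∈X e′∉X = begin-equality
  weight w (X - e +ₑ e′) +ᴿ w e     ≈⟨ +-congʳ (weight-insert w (e′∉X ∘ x∈p-y⇒x∈p X e)) ⟩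
  weight w (X - e) +ᴿ w e′ +ᴿ w e   ≈⟨ xy∙z≈xz∙y _ _ _ ⟩
  weight w (X - e) +ᴿ w e +ᴿ w e′   ≈⟨ +-congʳ (weight-insert w (x∉p-x X e)) ⟨
  weight w (X - e +ₑ e) +ᴿ w e′     ≡⟨ cong (λ Y → weight w Y +ᴿ w e′) (p-x+x≡p e∈X) ⟩
  weight w X +ᴿ w e′                ∎

-- Abstract so that with-abstraction over e ∈? E₀ does not unfold it.
abstract
  penalised : (Fin n → ℝ) → Subset n → ℝ → Fin n → ℝ
  penalised w E₀ μ e = w e +ᴿ (if does (e ∈? E₀) then 0ᴿ else μ)

  penalised-inside : ∀ (w : Fin n → ℝ) {E₀} μ {e} → e ∈ E₀ → penalised w E₀ μ e ≐ w e
  penalised-inside w {E₀} μ {e} e∈E₀ rewrite dec-true (e ∈? E₀) e∈E₀ = +-identityʳ (w e)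

  penalised-outside : ∀ (w : Fin n → ℝ) {E₀} μ {e} → e ∉ E₀ → penalised w E₀ μ e ≐ w e +ᴿ μ
  penalised-outside w {E₀} μ {e} e∉E₀ rewrite dec-false (e ∈? E₀) e∉E₀ = ≐-refl

  -- This is the Lagrangian for a bound on the number of elements outside `E₀`, with multiplier μ.
  weight-penalised : ∀ (w : Fin n → ℝ) E₀ μ X →
                     weight (penalised w E₀ μ) X ≐ weight w X +ᴿ ∣ X ─ E₀ ∣ · μ
  weight-penalised w [] μ [] = ≐-sym (+-identityʳ 0ᴿ)
  weight-penalised w (inside ∷ E₀) μ (inside ∷ X) =
    ≐-trans (+-cong (+-identityʳ (w zero)) (weight-penalised (w ∘ suc) E₀ μ X)) (≐-sym (+-assoc _ _ _))
  weight-penalised w (outside ∷ E₀) μ (inside ∷ X) =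
    ≐-trans (+-congˡ (weight-penalised (w ∘ suc) E₀ μ X)) (interchange _ _ _ _)
  weight-penalised w (inside ∷ E₀) μ (outside ∷ X) =
    ≐-trans (+-congˡ (weight-penalised (w ∘ suc) E₀ μ X)) (≐-sym (+-assoc _ _ _))
  weight-penalised w (outside ∷ E₀) μ (outside ∷ X) =
    ≐-trans (+-congˡ (weight-penalised (w ∘ suc) E₀ μ X)) (≐-sym (+-assoc _ _ _))

-- Minima over finite families

module _ {A : Set} (g : A → ℝ) where

  foldr-⊓-lower : ∀ v {x xs} → x List.∈ xs → foldr (λ y u → g y ⊓ᴿ u) v xs ≤ᴿ g x
  foldr-⊓-lower v (here refl) = ⊓-lowerˡ _ _
  foldr-⊓-lower v (there x∈xs) = ≤ᴿ-trans (⊓-lowerʳ _ _) (foldr-⊓-lower v x∈xs)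

  foldr-⊓-greatest : ∀ {z v xs} → z ≤ᴿ v → All (λ x → z ≤ᴿ g x) xs →
                     z ≤ᴿ foldr (λ y u → g y ⊓ᴿ u) v xs
  foldr-⊓-greatest z≤v [] = z≤v
  foldr-⊓-greatest z≤v (z≤x ∷ z≤xs) = ⊓-greatest z≤x (foldr-⊓-greatest z≤v z≤xs)

∈-subsets : ∀ (X : Subset n) → X List.∈ subsets n
∈-subsets [] = here refl
∈-subsets (inside ∷ X) = ∈-++⁺ˡ (∈-map⁺ (inside ∷_) (∈-subsets X))
∈-subsets (outside ∷ X) = ∈-++⁺ʳ _ (∈-map⁺ (outside ∷_) (∈-subsets X))

module _ (M : Matroid n) (w : Fin n → ℝ) where

  minWeight-lower : ∀ {S Y} b → IsBasis M Y → Y ⊆ S → minWeight M w S b ≤ᴿ weight w Y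
  minWeight-lower {S} {Y} (X₀ , _) basisY Y⊆S = foldr-⊓-lower (weight w) (weight w X₀)
    (∈-filter⁺ (λ X → isBasis? M X ×-dec (X ⊆? S)) (∈-subsets Y) (basisY , Y⊆S))

  minWeight-greatest : ∀ {S z} b → (∀ Y → IsBasis M Y → Y ⊆ S → z ≤ᴿ weight w Y) →
                       z ≤ᴿ minWeight M w S b
  minWeight-greatest {S} (X₀ , basisX₀ , X₀⊆S) z≤ = foldr-⊓-greatest (weight w)
    -- The fold is seeded with the weight of `X₀`, so the bound has to hold there too.
    (z≤ X₀ basisX₀ X₀⊆S)
    (All.map (λ {Y} (basisY , Y⊆S) → z≤ Y basisY Y⊆S)
      (all-filter (λ X → isBasis? M X ×-dec (X ⊆? S)) (subsets _)))

  minWeightBasis⇒locallyOptimal : ∀ {X e e′} → IsMinWeightBasis M w X →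
                                  ExchangePair M X e e′ → w e ≤ᴿ w e′
  minWeightBasis⇒locallyOptimal {X} {e} {e′} (_ , minX) (e∈X , e′∉X , basisX′) =
    +-cancelˡ-≤ᴿ (weight w X) (begin
      weight w X +ᴿ w e               ≲⟨ +-monoˡ-≤ᴿ (w e) (minX _ basisX′) ⟩
      weight w (X - e +ₑ e′) +ᴿ w e   ≈⟨ weight-exchange w e∈X e′∉X ⟩
      weight w X +ᴿ w e′              ∎)

  -- Induction on `X ─ Y`. A symmetric exchange brings an element e of `X ─ Y` into `Y` in place of
  -- some y; local optimality of `X` at the pair e, y shows that `Y` does not become heavier, while
  -- `X ─ Y` shrinks. Once `X ⊆ Y`, the two bases coincide.
  locallyOptimal⇒minWeightBasis : ∀ {X} → IsBasis M X →
    (∀ {e e′} → ExchangePair M X e e′ → w e ≤ᴿ w e′) → IsMinWeightBasis M w X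
  locallyOptimal⇒minWeightBasis {X} basisX local =
    basisX , λ Y basisY → go Y basisY (⊂-wellFounded (X ─ Y))
    where
    go : ∀ Y → IsBasis M Y → Acc _⊂_ (X ─ Y) → weight w X ≤ᴿ weight w Y
    go Y basisY (acc rec) with X ⊆? Y
    ... | yes X⊆Y = ≤ᴿ-reflexive (reflexive (cong (weight w)
            (⊆-antisym X⊆Y (proj₂ basisX Y (proj₁ basisY) X⊆Y))))
      where open AbelianGroup +-abelianGroup using (reflexive)
    ... | no X⊈Y with p⊈q⇒∃ X Y X⊈Y
    ...   | e , e∈X , e∉Y with symmetric-exchange M basisX basisY e∈X e∉Y
    ...     | y , y∈Y , y∉X , basisX′ , basisY′ = begin
      weight w X            ≲⟨ go Y′ basisY′ (rec (X─Y′⊆X─Y , e , x∈p∧x∉q⇒x∈p─q e∈X e∉Y , e∉X─Y′)) ⟩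
      weight w Y′           ≲⟨ Y′≤Y ⟩
      weight w Y            ∎
      where
      Y′ = Y - y +ₑ e

      e∉X─Y′ : e ∉ X ─ Y′
      e∉X─Y′ e∈X─Y′ = x∈p─q⇒x∉q X e∈X─Y′ x∈p+x

      X─Y′⊆X─Y : X ─ Y′ ⊆ X ─ Y
      X─Y′⊆X─Y {x} x∈ = x∈p∧x∉q⇒x∈p─q x∈X λ x∈Y →
        x∈p─q⇒x∉q X x∈ (p⊆p+x (x∈p∧x≢y⇒x∈p-y x∈Y λ { refl → y∉X x∈X }))
        where x∈X = p─q⊆p X Y′ x∈

      Y′≤Y : weight w Y′ ≤ᴿ weight w Y
      Y′≤Y = +-cancelʳ-≤ᴿ (w y) (begin
        weight w Y′ +ᴿ w y  ≈⟨ weight-exchange w y∈Y e∉Y ⟩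
        weight w Y +ᴿ w e   ≲⟨ +-monoʳ-≤ᴿ (weight w Y) (local (e∈X , y∉X , basisX′)) ⟩
        weight w Y +ᴿ w y   ∎)

-- The greedy algorithm

module Greedy {n} (M : Matroid n) (w : Fin n → ℝ) (E₀ : Subset n)
              (basis₀ : BasisWithin M E₀) where
  open IMD M w E₀ basis₀

  within : ∀ {S} → E₀ ⊆ S → BasisWithin M S
  within E₀⊆S = proj₁ basis₀ , proj₁ (proj₂ basis₀) , ⊆-trans (proj₂ (proj₂ basis₀)) E₀⊆S

  w*-lower : ∀ {Y} → IsBasis M Y → w* ≤ᴿ weight w Y
  w*-lower basisY = minWeight-lower M w (within ⊆⊤) basisY ⊆⊤

  w*-greatest : ∀ {x} → (∀ Y → IsBasis M Y → x ≤ᴿ weight w Y) → x ≤ᴿ w*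
  w*-greatest x≤ = minWeight-greatest M w (within ⊆⊤) λ Y basisY _ → x≤ Y basisY

  f-lower : ∀ {A Y} → IsBasis M Y → Y ⊆ E₀ ∪ A → f A ≤ᴿ weight w Y
  f-lower {A} = minWeight-lower M w (within (p⊆p∪q A))

  f-greatest : ∀ {A x} → (∀ Y → IsBasis M Y → Y ⊆ E₀ ∪ A → x ≤ᴿ weight w Y) → x ≤ᴿ f A
  f-greatest {A} = minWeight-greatest M w (within (p⊆p∪q A))

  -- Bases minimising a penalised weight

  MinPenalised : ℝ → Subset n → Set
  MinPenalised μ = IsMinWeightBasis M (penalised w E₀ μ)

  -- Since μ is nonnegative, `Y` pays no more penalty than `X`; the penalty of `X` then cancels from
  -- the comparison of penalised weights.
  minPenalised⇒cardinalityConstrainedMin : ∀ {μ X Y} → 0ᴿ ≤ᴿ μ → MinPenalised μ X → IsBasis M Y →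
    ∣ Y ─ E₀ ∣ ≤ ∣ X ─ E₀ ∣ → weight w X ≤ᴿ weight w Y
  minPenalised⇒cardinalityConstrainedMin {μ} {X} {Y} 0≤μ (_ , minX) basisY Y≤X =
    +-cancelʳ-≤ᴿ (∣ X ─ E₀ ∣ · μ) (begin
      weight w X +ᴿ ∣ X ─ E₀ ∣ · μ     ≈⟨ weight-penalised w E₀ μ X ⟨
      weight (penalised w E₀ μ) X      ≲⟨ minX Y basisY ⟩
      weight (penalised w E₀ μ) Y      ≈⟨ weight-penalised w E₀ μ Y ⟩
      weight w Y +ᴿ ∣ Y ─ E₀ ∣ · μ     ≲⟨ +-monoʳ-≤ᴿ (weight w Y) (·-monoˡ-≤ᴿ 0≤μ Y≤X) ⟩
      weight w Y +ᴿ ∣ X ─ E₀ ∣ · μ     ∎)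

  -- If the best exchange gained nothing, no exchange would. Then `X` would be locally, hence
  -- globally, optimal and could not exceed `w*`.
  optimalGain-positive : ∀ {X e e′} → w* <ᴿ weight w X → IsBasis M X →
    OptimalExchangePair M w X e e′ → ¬ (w e -ᴿ w e′ ≤ᴿ 0ᴿ)
  optimalGain-positive w*<X basisX (_ , optimal) gain≤0 =
    <ᴿ⇒≱ᴿ w*<X (w*-greatest (proj₂ minX))
    where
    minX = locallyOptimal⇒minWeightBasis M w basisX λ {d} {d′} pair →
      x-y≤0⇒x≤y (≤ᴿ-trans (optimal d d′ pair) gain≤0)

  0≤optimalGain : ∀ {X e e′} → w* <ᴿ weight w X → IsBasis M X →
    OptimalExchangePair M w X e e′ → 0ᴿ ≤ᴿ w e -ᴿ w e′
  0≤optimalGain w*<X basisX pair = ≮ᴿ⇒≥ᴿ (optimalGain-positive w*<X basisX pair ∘ <ᴿ⇒≤ᴿ)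

  -- All of `X` lies in `E₀`. An exchange within `E₀` is no improvement by minimality there, and one
  -- that brings in an element from outside pays μ, which covers its gain.
  initial-minPenalised : ∀ {X μ} → IsMinWeightBasis (M ∣ᴹ E₀) w X →
    (∀ {d d′} → ExchangePair M X d d′ → w d -ᴿ w d′ ≤ᴿ μ) → MinPenalised μ X
  initial-minPenalised {X} {μ} minX@(basisX@((_ , X⊆E₀) , _) , _) gain≤μ =
    locallyOptimal⇒minWeightBasis M _ (basis∣ᴹ⇒basis M basis₀ basisX) local
    where
    local : ∀ {d d′} → ExchangePair M X d d′ → penalised w E₀ μ d ≤ᴿ penalised w E₀ μ d′
    local {d} {d′} pair@(d∈X , d′∉X , basisX′) with d′ ∈? E₀
    ... | yes d′∈E₀ = begin
      penalised w E₀ μ d   ≈⟨ penalised-inside w μ (X⊆E₀ d∈X) ⟩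
      w d                  ≲⟨ minWeightBasis⇒locallyOptimal (M ∣ᴹ E₀) w minX
                                (d∈X , d′∉X , basis⇒basis∣ᴹ M basisX′ (exchange-⊆ X⊆E₀ d′∈E₀)) ⟩
      w d′                 ≈⟨ penalised-inside w μ d′∈E₀ ⟨
      penalised w E₀ μ d′  ∎
    ... | no d′∉E₀ = begin
      penalised w E₀ μ d   ≈⟨ penalised-inside w μ (X⊆E₀ d∈X) ⟩
      w d                  ≲⟨ x-y≤z⇒x≤y+z (gain≤μ pair) ⟩
      w d′ +ᴿ μ            ≈⟨ penalised-outside w μ d′∉E₀ ⟨
      penalised w E₀ μ d′  ∎

  -- A single exchange

  module Step {μ X e e′} (0≤μ : 0ᴿ ≤ᴿ μ) (minX : MinPenalised μ X)
              (w*<X : w* <ᴿ weight w X) (pair : OptimalExchangePair M w X e e′) where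

    basisX : IsBasis M X
    basisX = proj₁ minX

    gain : ℝ
    gain = w e -ᴿ w e′

    e∈X : e ∈ X
    e∈X = proj₁ (proj₁ pair)

    e′∉X : e′ ∉ X
    e′∉X = proj₁ (proj₂ (proj₁ pair))

    0≤gain : 0ᴿ ≤ᴿ gain
    0≤gain = 0≤optimalGain w*<X basisX pair

    e≰e′ : ¬ (w e ≤ᴿ w e′)
    e≰e′ = optimalGain-positive w*<X basisX pair ∘ x≤y⇒x-y≤0

    local : ∀ {d d′} → ExchangePair M X d d′ → penalised w E₀ μ d ≤ᴿ penalised w E₀ μ d′
    local = minWeightBasis⇒locallyOptimal M _ minX

    -- The next four inequalities resolve the penalties in `local` according to which elements of
    -- the pair lie in `E₀`.
    inside-inside : ∀ {d d′} → ExchangePair M X d d′ → d ∈ E₀ → d′ ∈ E₀ → w d ≤ᴿ w d′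
    inside-inside {d} {d′} p d∈E₀ d′∈E₀ = begin
      w d                  ≈⟨ penalised-inside w μ d∈E₀ ⟨
      penalised w E₀ μ d   ≲⟨ local p ⟩
      penalised w E₀ μ d′  ≈⟨ penalised-inside w μ d′∈E₀ ⟩
      w d′                 ∎

    inside-outside : ∀ {d d′} → ExchangePair M X d d′ → d ∈ E₀ → d′ ∉ E₀ → w d ≤ᴿ w d′ +ᴿ μ
    inside-outside {d} {d′} p d∈E₀ d′∉E₀ = begin
      w d                  ≈⟨ penalised-inside w μ d∈E₀ ⟨
      penalised w E₀ μ d   ≲⟨ local p ⟩
      penalised w E₀ μ d′  ≈⟨ penalised-outside w μ d′∉E₀ ⟩
      w d′ +ᴿ μ            ∎

    outside-inside : ∀ {d d′} → ExchangePair M X d d′ → d ∉ E₀ → d′ ∈ E₀ → w d +ᴿ μ ≤ᴿ w d′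
    outside-inside {d} {d′} p d∉E₀ d′∈E₀ = begin
      w d +ᴿ μ             ≈⟨ penalised-outside w μ d∉E₀ ⟨
      penalised w E₀ μ d   ≲⟨ local p ⟩
      penalised w E₀ μ d′  ≈⟨ penalised-inside w μ d′∈E₀ ⟩
      w d′                 ∎

    outside-outside : ∀ {d d′} → ExchangePair M X d d′ → d ∉ E₀ → d′ ∉ E₀ → w d ≤ᴿ w d′
    outside-outside {d} {d′} p d∉E₀ d′∉E₀ = +-cancelʳ-≤ᴿ μ (begin
      w d +ᴿ μ             ≈⟨ penalised-outside w μ d∉E₀ ⟨
      penalised w E₀ μ d   ≲⟨ local p ⟩
      penalised w E₀ μ d′  ≈⟨ penalised-outside w μ d′∉E₀ ⟩
      w d′ +ᴿ μ            ∎)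

    -- In each of the other three cases the inequalities above give `w e ≤ᴿ w e′`, contradicting the
    -- positive gain.
    crosses : e ∈ E₀ × e′ ∉ E₀
    crosses with e ∈? E₀ | e′ ∈? E₀
    ... | yes e∈E₀ | no e′∉E₀ = e∈E₀ , e′∉E₀
    ... | yes e∈E₀ | yes e′∈E₀ = ⊥-elim (e≰e′ (inside-inside (proj₁ pair) e∈E₀ e′∈E₀))
    ... | no e∉E₀ | no e′∉E₀ = ⊥-elim (e≰e′ (outside-outside (proj₁ pair) e∉E₀ e′∉E₀))
    ... | no e∉E₀ | yes e′∈E₀ = ⊥-elim (e≰e′
      (≤ᴿ-trans (0≤x⇒y≤y+x (w e) 0≤μ) (outside-inside (proj₁ pair) e∉E₀ e′∈E₀)))

    gain≤μ : gain ≤ᴿ μ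
    gain≤μ = x≤y+z⇒x-y≤z (inside-outside (proj₁ pair) (proj₁ crosses) (proj₂ crosses))

    -- Local optimality survives the change of penalty from μ to `gain`. Pairs on the same side of
    -- `E₀` do not feel the change, and pairs leading out of `E₀` are controlled by the optimality
    -- of the chosen exchange.
    local′ : ∀ {d d′} → ExchangePair M X d d′ → penalised w E₀ gain d ≤ᴿ penalised w E₀ gain d′
    local′ {d} {d′} p with d ∈? E₀ | d′ ∈? E₀
    ... | yes d∈E₀ | yes d′∈E₀ = begin
      penalised w E₀ gain d   ≈⟨ penalised-inside w gain d∈E₀ ⟩
      w d                     ≲⟨ inside-inside p d∈E₀ d′∈E₀ ⟩
      w d′                    ≈⟨ penalised-inside w gain d′∈E₀ ⟨
      penalised w E₀ gain d′  ∎
    ... | yes d∈E₀ | no d′∉E₀ = begin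
      penalised w E₀ gain d   ≈⟨ penalised-inside w gain d∈E₀ ⟩
      w d                     ≲⟨ x-y≤z⇒x≤y+z (proj₂ pair d d′ p) ⟩
      w d′ +ᴿ gain            ≈⟨ penalised-outside w gain d′∉E₀ ⟨
      penalised w E₀ gain d′  ∎
    -- Only here does the size of the new penalty matter: it must not exceed the old one.
    ... | no d∉E₀ | yes d′∈E₀ = begin
      penalised w E₀ gain d   ≈⟨ penalised-outside w gain d∉E₀ ⟩
      w d +ᴿ gain             ≲⟨ +-monoʳ-≤ᴿ (w d) gain≤μ ⟩
      w d +ᴿ μ                ≲⟨ outside-inside p d∉E₀ d′∈E₀ ⟩
      w d′                    ≈⟨ penalised-inside w gain d′∈E₀ ⟨
      penalised w E₀ gain d′  ∎
    ... | no d∉E₀ | no d′∉E₀ = begin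
      penalised w E₀ gain d   ≈⟨ penalised-outside w gain d∉E₀ ⟩
      w d +ᴿ gain             ≲⟨ +-monoˡ-≤ᴿ gain (outside-outside p d∉E₀ d′∉E₀) ⟩
      w d′ +ᴿ gain            ≈⟨ penalised-outside w gain d′∉E₀ ⟨
      penalised w E₀ gain d′  ∎

    -- At penalty `gain` the elements e and e′ have equal penalised weight, so the exchange leads
    -- from one minimiser to another.
    minX′ : MinPenalised gain (X - e +ₑ e′)
    minX′ = proj₂ (proj₂ (proj₁ pair)) , λ Y basisY → ≤ᴿ-trans X′≤X
      (proj₂ (locallyOptimal⇒minWeightBasis M _ basisX local′) Y basisY)
      where
      w′ = penalised w E₀ gain

      w′e≐w′e′ : w′ e ≐ w′ e′
      w′e≐w′e′ = begin-equality
        w′ e                 ≈⟨ penalised-inside w gain (proj₁ crosses) ⟩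
        w e                  ≈⟨ x-y+y≐x (w e′) (w e) ⟨
        w e -ᴿ w e′ +ᴿ w e′  ≈⟨ +-comm gain (w e′) ⟩
        w e′ +ᴿ gain         ≈⟨ penalised-outside w gain (proj₂ crosses) ⟨
        w′ e′                ∎

      X′≤X : weight w′ (X - e +ₑ e′) ≤ᴿ weight w′ X
      X′≤X = +-cancelʳ-≤ᴿ (w′ e) (begin
        weight w′ (X - e +ₑ e′) +ᴿ w′ e  ≈⟨ weight-exchange w′ e∈X e′∉X ⟩
        weight w′ X +ᴿ w′ e′             ≈⟨ +-congˡ w′e≐w′e′ ⟨
        weight w′ X +ᴿ w′ e              ∎)

  -- The run of the algorithm

  LagrangeOptimal : Subset n → Set
  LagrangeOptimal X = ∃[ μ ] 0ᴿ ≤ᴿ μ × MinPenalised μ X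

  -- The first multiplier is the gain of the first exchange, which bounds all gains available at
  -- `X`. If the loop stops at once, `X` has minimum weight among all bases and the multiplier 0
  -- works.
  initial-lagrangeOptimal : ∀ {X es} → IsMinWeightBasis (M ∣ᴹ E₀) w X → Loop X es → LagrangeOptimal X
  initial-lagrangeOptimal {X} minX (stop w*≮X) =
    0ᴿ , ≤ᴿ-refl , initial-minPenalised minX λ p →
      x≤y⇒x-y≤0 (minWeightBasis⇒locallyOptimal M w
        (basis∣ᴹ⇒basis M basis₀ (proj₁ minX) , λ Y basisY →
          ≤ᴿ-trans (≮ᴿ⇒≥ᴿ w*≮X) (w*-lower basisY)) p)
  initial-lagrangeOptimal minX (step {e} {e′} w*<X pair _) =
    w e -ᴿ w e′ , 0≤optimalGain w*<X (basis∣ᴹ⇒basis M basis₀ (proj₁ minX)) pair ,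
    initial-minPenalised minX λ {d} {d′} → proj₂ pair d d′

  -- The state after i exchanges starting from `X`. The elements of `X` outside `E₀` are kept in the
  -- formulas because the recursion restarts from later bases.
  record Stage (X : Subset n) (es : List (Fin n)) (i : ℕ) : Set where
    field
      basis          : Subset n
      optimal        : LagrangeOptimal basis
      new-elements   : basis ─ E₀ ≡ (X ─ E₀) ∪ ⋃ (map ⁅_⁆ (take i es))
      number-of-new  : ∣ basis ─ E₀ ∣ ≡ ∣ X ─ E₀ ∣ ℕ.+ i
      final          : length es ≡ i → weight w basis ≤ᴿ w*

  stage : ∀ {X es} → LagrangeOptimal X → Loop X es → ∀ i → i ≤ length es → Stage X es i
  stage {X} {es} optX loop zero _ = record
    { basis = X
    ; optimal = optX
    ; new-elements = sym (∪-identityʳ (X ─ E₀))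
    ; number-of-new = sym (ℕ.+-identityʳ _)
    ; final = final loop
    }
    where
    -- A `step` records an element, so an empty list can only come from `stop`.
    final : ∀ {es} → Loop X es → length es ≡ 0 → weight w X ≤ᴿ w*
    final (stop w*≮X) _ = ≮ᴿ⇒≥ᴿ w*≮X
  stage {X} (μ , 0≤μ , minX) (step {e} {e′} {es} w*<X pair loop) (suc i) (ℕ.s≤s i≤) = record
    { basis = Stage.basis rest
    ; optimal = Stage.optimal rest
    ; new-elements = trans (Stage.new-elements rest)
        (trans (cong (_∪ ⋃ (map ⁅_⁆ (take i es))) new) (∪-assoc (X ─ E₀) ⁅ e′ ⁆ _))
    ; number-of-new = trans (Stage.number-of-new rest)
        (trans (cong (ℕ._+ i) ∣new∣) (sym (ℕ.+-suc ∣ X ─ E₀ ∣ i)))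
    ; final = Stage.final rest ∘ ℕ.suc-injective
    }
    where
    open Step 0≤μ minX w*<X pair
    rest = stage (gain , 0≤gain , minX′) loop i i≤

    new : (X - e +ₑ e′) ─ E₀ ≡ (X ─ E₀) +ₑ e′
    new = p-x+y─q≡[p─q]+y (proj₁ crosses) (proj₂ crosses)

    ∣new∣ : ∣ (X - e +ₑ e′) ─ E₀ ∣ ≡ suc ∣ X ─ E₀ ∣
    ∣new∣ = trans (cong ∣_∣ new) (∣p+x∣≡1+∣p∣ (e′∉X ∘ p─q⊆p X E₀))

  -- Only an upper bound holds: the increment condition fixes the number of new elements but permits
  -- dropping old ones.
  feasible-∣∣≤ : ∀ {B} → Feasible B → ∀ i → ∣ B i ∣ ≤ toℕ i
  feasible-∣∣≤ {B} feasible = <-weakInduction (λ i → ∣ B i ∣ ≤ toℕ i)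
    (ℕ.≤-reflexive (trans (cong ∣_∣ initial) (∣⊥∣≡0 n)))
    λ i ∣Bᵢ∣≤i → ℕ.≤-trans (∣q∣≤∣q─p∣+∣p∣ (B (suc i)) (B (inject₁ i)))
      (ℕ.+-mono-≤ (ℕ.≤-reflexive (increment i))
        (subst (∣ B (inject₁ i) ∣ ≤_) (toℕ-inject₁ i) ∣Bᵢ∣≤i))
    where open Feasible feasible

  -- The recorded elements

  module Output {X₀ es} (minX₀ : IsMinWeightBasis (M ∣ᴹ E₀) w X₀) (loop : Loop X₀ es) where

    chosen : ℕ → Subset n
    chosen i = ⋃ (map ⁅_⁆ (take i es))

    stageᵢ : ∀ i → i ≤ length es → Stage X₀ es i
    stageᵢ = stage (initial-lagrangeOptimal minX₀ loop) loop

    X₀─E₀≡⊥ : X₀ ─ E₀ ≡ ⊥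
    X₀─E₀≡⊥ = p⊆q⇒p─q≡⊥ (proj₂ (proj₁ (proj₁ minX₀)))

    stage-chosen : ∀ {i} (s : Stage X₀ es i) → Stage.basis s ─ E₀ ≡ chosen i
    stage-chosen {i} s = trans (Stage.new-elements s)
      (trans (cong (_∪ chosen i) X₀─E₀≡⊥) (∪-identityˡ (chosen i)))

    ∣stage∣ : ∀ {i} (s : Stage X₀ es i) → ∣ Stage.basis s ─ E₀ ∣ ≡ i
    ∣stage∣ {i} s = trans (Stage.number-of-new s)
      (cong (ℕ._+ i) (trans (cong ∣_∣ X₀─E₀≡⊥) (∣⊥∣≡0 n)))

    -- Counting the new elements of the stage basis shows that the recorded elements are distinct.
    ∣chosen∣ : ∀ {i} → i ≤ length es → ∣ chosen i ∣ ≡ i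
    ∣chosen∣ i≤k = trans (cong ∣_∣ (sym (stage-chosen (stageᵢ _ i≤k)))) (∣stage∣ (stageᵢ _ i≤k))

    chosen⊆∁E₀ : ∀ {i} → i ≤ length es → chosen i ⊆ ∁ E₀
    chosen⊆∁E₀ i≤k = subst (_⊆ ∁ E₀) (stage-chosen s) (x∉p⇒x∈∁p ∘ x∈p─q⇒x∉q (Stage.basis s))
      where s = stageᵢ _ i≤k

    length≤T : length es ≤ T
    length≤T = subst (ℕ._≤ T) (∣chosen∣ ℕ.≤-refl) (p⊆q⇒∣p∣≤∣q∣ (chosen⊆∁E₀ ℕ.≤-refl))

    -- The new elements of the stage basis are exactly those in `chosen i`, so this basis competes
    -- in the minimum defining `f A`.
    f≤stage : ∀ {i A} (s : Stage X₀ es i) → chosen i ⊆ A → f A ≤ᴿ weight w (Stage.basis s)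
    f≤stage {i} {A} s chosen⊆A =
      f-lower (proj₁ (proj₂ (proj₂ (Stage.optimal s)))) λ {x} x∈ →
        [ p⊆p∪q A , q⊆p∪q E₀ A ∘ chosen⊆A ∘ subst (x ∈_) (stage-chosen s) ]′
          (x∈p∪q⁻ E₀ _ (p⊆q∪[p─q] (Stage.basis s) E₀ x∈))

    -- A basis within `E₀ ∪ B` has at most i elements outside `E₀`, the number that the stage basis
    -- has.
    stage≤f : ∀ {i B} (s : Stage X₀ es i) → ∣ B ∣ ≤ i → weight w (Stage.basis s) ≤ᴿ f B
    stage≤f {i} {B} s B≤i = f-greatest λ Y basisY Y⊆ →
      minPenalised⇒cardinalityConstrainedMin 0≤μ min basisY
        (ℕ.≤-trans (p⊆q⇒∣p∣≤∣q∣ (p⊆q∪r⇒p─q⊆r Y⊆)) (subst (∣ B ∣ ≤_) (sym (∣stage∣ s)) B≤i))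
      where
      0≤μ = proj₁ (proj₂ (Stage.optimal s))
      min = proj₂ (proj₂ (Stage.optimal s))

    -- Completed sequences

    module Completion {A : Sequence} (completes : Completes es A) where
      open Completes completes

      -- Collects what the greedy steps and the arbitrary later additions have in common.
      record Growth (i : Fin T) : Set where
        field
          ⊆-suc      : A (inject₁ i) ⊆ A (suc i)
          ∣suc∣      : ∣ A (suc i) ∣ ≡ suc ∣ A (inject₁ i) ∣
          preserves  : A (inject₁ i) ⊆ ∁ E₀ → A (suc i) ⊆ ∁ E₀

      growth : ∀ i → Growth i
      -- The sets at i and i + 1 are both prefixes of the output exactly when i is strictly below
      -- its length.
      growth i with ℕ.<-≤-connex (toℕ i) (length es)
      ... | inj₁ i<k = record
        { ⊆-suc = subst₂ _⊆_ (sym Aᵢ) (sym Aₛᵢ) (⋃-take-⊆ (toℕ i) es)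
        ; ∣suc∣ = trans (trans (cong ∣_∣ Aₛᵢ) (∣chosen∣ i<k))
            (cong suc (sym (trans (cong ∣_∣ Aᵢ) (∣chosen∣ (ℕ.<⇒≤ i<k)))))
        ; preserves = λ _ → subst (_⊆ ∁ E₀) (sym Aₛᵢ) (chosen⊆∁E₀ i<k)
        }
        where
        Aₛᵢ : A (suc i) ≡ chosen (suc (toℕ i))
        Aₛᵢ = prefix (suc i) i<k

        Aᵢ : A (inject₁ i) ≡ chosen (toℕ i)
        Aᵢ = trans (prefix (inject₁ i) (subst (ℕ._≤ length es) (sym (toℕ-inject₁ i)) (ℕ.<⇒≤ i<k)))
          (cong chosen (toℕ-inject₁ i))
      ... | inj₂ k≤i with beyond i k≤i
      ...   | e′ , e′∉ , Aₛᵢ = record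
        { ⊆-suc = subst (A (inject₁ i) ⊆_) (sym Aₛᵢ) p⊆p+x
        ; ∣suc∣ = trans (cong ∣_∣ Aₛᵢ) (∣p+x∣≡1+∣p∣ (e′∉ ∘ q⊆p∪q E₀ (A (inject₁ i))))
        ; preserves = λ A⊆ → subst (_⊆ ∁ E₀) (sym Aₛᵢ)
            (p+x⊆q A⊆ (x∉p⇒x∈∁p (e′∉ ∘ p⊆p∪q (A (inject₁ i)))))
        }

      initial-⊥ : A zero ≡ ⊥
      initial-⊥ = prefix zero ℕ.z≤n

      feasible : Feasible A
      feasible = record
        { outside-E₀ = <-weakInduction (λ i → A i ⊆ ∁ E₀)
            (subst (_⊆ ∁ E₀) (sym initial-⊥) ⊥⊆) (λ i → Growth.preserves (growth i))
        ; initial = initial-⊥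
        ; increment = increment
        }
        where
        increment : ∀ i → ∣ A (suc i) ─ A (inject₁ i) ∣ ≡ 1
        -- By inclusion the union of the two sets is `A (suc i)`, which has one element more than
        -- its predecessor.
        increment i = ℕ.+-cancelʳ-≡ ∣ A (inject₁ i) ∣ _ 1
          (trans (∣q─p∣+∣p∣≡∣q∪p∣ (A (suc i)) (A (inject₁ i)))
            (trans (cong ∣_∣ (p⊆q⇒q∪p≡q (Growth.⊆-suc (growth i)))) (Growth.∣suc∣ (growth i))))

      chosen⊆A : ∀ i → length es ≤ toℕ i → chosen (length es) ⊆ A i
      chosen⊆A = <-weakInduction _
        (λ k≤0 → subst (chosen (length es) ⊆_)
          (trans (cong chosen (ℕ.n≤0⇒n≡0 k≤0)) (sym initial-⊥)) id)
        λ i IH k≤1+i → grow i IH (ℕ.m≤n⇒m<n∨m≡n k≤1+i)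
        where
        grow : ∀ i → (length es ≤ toℕ (inject₁ i) → chosen (length es) ⊆ A (inject₁ i)) →
               length es ℕ.< suc (toℕ i) ⊎ length es ≡ suc (toℕ i) → chosen (length es) ⊆ A (suc i)
        grow i IH (inj₁ k<1+i) = Growth.⊆-suc (growth i) ∘
          IH (subst (length es ≤_) (sym (toℕ-inject₁ i)) (ℕ.s≤s⁻¹ k<1+i))
        grow i IH (inj₂ k≡1+i) = subst (chosen (length es) ⊆_)
          (trans (cong chosen k≡1+i) (sym (prefix (suc i) (ℕ.≤-reflexive (sym k≡1+i))))) id

      -- Up to the length of the output, the stage basis with the same index separates the two
      -- values. Later sets contain all recorded elements, so their value is already at most `w*`, a
      -- lower bound for every `f (B i)`.
      f-minimal : ∀ {B} → Feasible B → ∀ i → f (A i) ≤ᴿ f (B i)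
      f-minimal {B} feasibleB i with ℕ.≤-total (toℕ i) (length es)
      ... | inj₁ i≤k = ≤ᴿ-trans
        (f≤stage s (subst (chosen (toℕ i) ⊆_) (sym (prefix i i≤k)) id))
        (stage≤f s (feasible-∣∣≤ feasibleB i))
        where s = stageᵢ (toℕ i) i≤k
      ... | inj₂ k≤i = begin
        f (A i)                   ≲⟨ f≤stage s (chosen⊆A i k≤i) ⟩
        weight w (Stage.basis s)  ≲⟨ Stage.final s refl ⟩
        w*                        ≲⟨ f-greatest (λ _ basisY _ → w*-lower basisY) ⟩
        f (B i)                   ∎
        where s = stageᵢ (length es) ℕ.≤-refl

      optimal : Optimal A
      optimal = feasible , λ B feasibleB → sumᴿ-mono-≤ᴿ (f-minimal feasibleB)

theorem1 : ∀ {n : ℕ} (M : Matroid n) (w : Fin n → ℝ) (E₀ : Subset n)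
    (basis₀ : BasisWithin M E₀) → let open IMD M w E₀ basis₀ in
    ∀ (es : List (Fin n)) → GreedyOutput es →
    length es ≤ T × (∀ (A : Sequence) → Completes es A → Optimal A)
theorem1 M w E₀ basis₀ es (X₀ , minX₀ , loop) =
  length≤T , λ A completes → Completion.optimal completes
  where
  open Greedy M w E₀ basis₀
  open Output minX₀ loop
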